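{- Let $n,m\ge 2$ be integers, and regard $C_{2n}\times C_{2m}$ as a subgraph of $M(C_{2n})\times M(C_{2m})$ (via the natural inclusion of $C_{2n}$ into $M(C_{2n})$ and of $C_{2m}$ into $M(C_{2m})$, whose original vertices are kept). If $(u,v)$ is a vertex of $M(C_{2n})\times M(C_{2m})$ with $(u,v)\notin V(C_{2n}\times C_{2m})$, then $$f\big(M(C_{2n})\times M(C_{2m}),(u,v)\big)\le f\big(M(C_{2n})\big)\,f\big(M(C_{2m})\big).$$
   Context: A distribution of pebbles on a graph assigns a nonnegative integer number of pebbles to each vertex. A pebbling move removes two pebbles from a vertex and places one pebble on an adjacent vertex. For a connected graph $G$ and a vertex $v$, $f(G,v)$ is the smallest integer $N$ such that from every distribution of $N$ pebbles on $G$ one pebble can be moved to $v$ by a sequence of pebbling moves; $f(G)=\max_{v\in V(G)} f(G,v)$. $C_k$ denotes the cycle on $k$ vertices. The middle graph $M(G)$ of a graph $G$ is obtained from $G$ by inserting a new vertex into each edge of $G$ (subdividing it), and joining two new vertices by an edge whenever the two edges of $G$ they were inserted into share a common endpoint; the original vertices of $G$ are vertices of $M(G)$. For graphs $G_1,G_2$, the Cartesian product $G_1\times G_2$ has vertex set $V(G_1)\times V(G_2)$, with $(u_1,v_1)$ adjacent to $(u_2,v_2)$ iff either $u_1=u_2$ and $v_1v_2\in E(G_2)$, or $u_1u_2\in E(G_1)$ and $v_1=v_2$. Thus a vertex $(u,v)$ of $M(C_{2n})\times M(C_{2m})$ lies outside $C_{2n}\times C_{2m}$ exactly when $u$ or $v$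 is one of the inserted (subdivision) vertices. -}

module Defs where

open import Level using (0ℓ)
open import Data.Nat using (ℕ; zero; suc; _+_; _*_; _∸_; _≤_; _<_; NonZero)
open import Data.Nat.DivMod using (_%_; m%n<n)
open import Data.Fin using (Fin; toℕ; fromℕ<)
open import Data.Sum using (_⊎_; inj₁; inj₂)
open import Data.Product using (Σ; ∃; ∃-syntax; _×_; _,_; proj₁; proj₂)
open import Data.Nat.ListAction using (sum)
open import Data.Empty using (⊥)
open import Data.List using (List; map; _++_; cartesianProduct; allFin)
open import Data.List.Membership.Propositional using (_∈_)
open import Data.List.Membership.Propositional.Properties
  using (∈-allFin; ∈-map⁺; ∈-map⁻; ∈-++⁺ˡ; ∈-++⁺ʳ; ∈-cartesianProduct⁺)
open import Data.List.Relation.Unary.Unique.Propositional using (Unique)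
import Data.List.Relation.Unary.Unique.Propositional.Properties as UP
open import Relation.Binary.PropositionalEquality using (_≡_; _≢_; refl; trans; sym)
open import Relation.Binary.Construct.Closure.ReflexiveTransitive using (Star)
open import Relation.Nullary using (¬_)

record Graph : Set₁ where
  field
    V        : Set
    Adj      : V → V → Set
    vertices : List V
    complete : ∀ v → v ∈ vertices
    unique   : Unique vertices
open Graph public

Distribution : Graph → Set
Distribution G = V G → ℕ

size : (G : Graph) → Distribution G → ℕ
size G d = sum (map d (vertices G))

Move : (G : Graph) → Distribution G → Distribution G → Set
Move G d d' = Σ (V G) λ x → Σ (V G) λ y →
    Adj G x y × 2 ≤ d x × d' x + 2 ≡ d x × d' y ≡ d y + 1
  × (∀ z → z ≢ x → z ≢ y → d' z ≡ d z)

_⊢_⇒*_ : (G : Graph) → Distribution G → Distribution G → Set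
G ⊢ d ⇒* d' = Star (Move G) d d'

Solvable : (G : Graph) → Distribution G → V G → Set
Solvable G d v = Σ (Distribution G) λ d' → (G ⊢ d ⇒* d') × 1 ≤ d' v

AllSolvable : (G : Graph) → V G → ℕ → Set
AllSolvable G v N = ∀ (d : Distribution G) → size G d ≡ N → Solvable G d v

IsPebblingNumberAt : (G : Graph) → V G → ℕ → Set
IsPebblingNumberAt G v N = AllSolvable G v N × (∀ M → M < N → ¬ AllSolvable G v M)

IsPebblingNumber : Graph → ℕ → Set
IsPebblingNumber G N =
    (∀ v → ∃[ Nv ] IsPebblingNumberAt G v Nv × Nv ≤ N)
  × (∃[ v ] IsPebblingNumberAt G v N)

_□_ : Graph → Graph → Graph
G □ H = record
  { V        = V G × V H
  ; Adj      = λ p q → (proj₁ p ≡ proj₁ q × Adj H (proj₂ p) (proj₂ q))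
                     ⊎ (Adj G (proj₁ p) (proj₁ q) × proj₂ p ≡ proj₂ q)
  ; vertices = cartesianProduct (vertices G) (vertices H)
  ; complete = λ p → ∈-cartesianProduct⁺ (complete G (proj₁ p)) (complete H (proj₂ p))
  ; unique   = UP.cartesianProduct⁺ (unique G) (unique H)
  }

-- The cycle C_k (k = suc k', intended k ≥ 3): vertices Fin k,
-- edges e_i = {i, i+1 mod k}, i : Fin k.

next : ∀ {k} → Fin (suc k) → Fin (suc k)
next {k} i = fromℕ< (m%n<n (suc (toℕ i)) (suc k))

IsEndpoint : ∀ {k} → Fin (suc k) → Fin (suc k) → Set
IsEndpoint i e = i ≡ e ⊎ i ≡ next e

-- The middle graph M(C_k): original vertices (inj₁ i) and one inserted
-- vertex (inj₂ e) per edge e_e of C_k.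

MAdj : ∀ {k} → Fin (suc k) ⊎ Fin (suc k) → Fin (suc k) ⊎ Fin (suc k) → Set
MAdj (inj₁ i) (inj₁ j) = ⊥
MAdj (inj₁ i) (inj₂ e) = IsEndpoint i e
MAdj (inj₂ e) (inj₁ i) = IsEndpoint i e
MAdj (inj₂ e) (inj₂ e') = e ≢ e' × ∃[ i ] IsEndpoint i e × IsEndpoint i e'

private
  inj₁-inj : ∀ {A B : Set} {x y : A} → inj₁ {B = B} x ≡ inj₁ y → x ≡ y
  inj₁-inj refl = refl
  inj₂-inj : ∀ {A B : Set} {x y : B} → inj₂ {A = A} x ≡ inj₂ y → x ≡ y
  inj₂-inj refl = refl

  MV-complete : ∀ k (v : Fin k ⊎ Fin k) → v ∈ (map inj₁ (allFin k) ++ map inj₂ (allFin k))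
  MV-complete k (inj₁ i) = ∈-++⁺ˡ (∈-map⁺ inj₁ (∈-allFin i))
  MV-complete k (inj₂ i) = ∈-++⁺ʳ (map inj₁ (allFin k)) (∈-map⁺ inj₂ (∈-allFin i))

  MV-disj : ∀ k {v : Fin k ⊎ Fin k} → ¬ (v ∈ map inj₁ (allFin k) × v ∈ map inj₂ (allFin k))
  MV-disj k (p , q) with ∈-map⁻ inj₁ p | ∈-map⁻ inj₂ q
  ... | _ , _ , refl | _ , _ , ()

MiddleCycle : ℕ → Graph
MiddleCycle k' = record
  { V        = Fin (suc k') ⊎ Fin (suc k')
  ; Adj      = MAdj
  ; vertices = map inj₁ (allFin (suc k')) ++ map inj₂ (allFin (suc k'))
  ; complete = MV-complete (suc k')
  ; unique   = UP.++⁺ (UP.map⁺ inj₁-inj (UP.allFin⁺ (suc k')))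
                      (UP.map⁺ inj₂-inj (UP.allFin⁺ (suc k')))
                      (MV-disj (suc k'))
  }

-- M(C_{2n}) for n ≥ 1  (2n = suc (2n - 1))
M[C2_] : ℕ → Graph
M[C2 n ] = MiddleCycle (2 * n ∸ 1)

{-# OPTIONS --safe #-}
module Submission where

-- Let u be an inserted vertex of G = M(C₂ₙ), let H = M(C₂ₘ), and let b and c be
-- the pebbling numbers of G and H.  Any k 2ⁿ + 2n + ⌊2ⁿ/3⌋ pebbles on G bring k
-- pebbles to u: move pairs from the original vertices towards u along the two
-- arms of the cycle.  At most one pebble is lost on each of the 2n original
-- vertices, and the two originals next to the vertex opposite u behave like the
-- far edge of an odd cycle, which costs the further 2ⁿ/3.  Given b c pebbles on
-- the product, push every fibre G × {h} to (u , h).  The 4m fibres waste fewer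
-- than b c − 2ⁿ (c − 1) pebbles in total, because b ≥ 2ⁿ⁺¹ + 2n − 2 and
-- c ≥ 2ᵐ⁺¹ + 2m − 2, so at least c pebbles arrive in {u} × H and solve it there.
-- Only for n = m = 2 can the waste be too large by one, which an extra move repairs.

open import Defs
open import Data.Nat
open import Data.Nat.Properties
open import Data.Nat.DivMod
open import Data.Nat.ListAction using (sum)
open import Data.Nat.ListAction.Properties using (sum-++; sum-↭)
open import Data.Nat.Tactic.RingSolver using (solve-∀)
open import Data.Fin using (Fin; zero; suc; toℕ; fromℕ<)
import Data.Fin.Properties as Fin
open import Data.Sum using (_⊎_; inj₁; inj₂)
import Data.Sum.Properties as Sum
open import Data.Product using (Σ; ∃-syntax; _×_; _,_; proj₁; proj₂; swap)
import Data.Product.Properties as Product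
open import Data.List using (List; []; _∷_; map; _++_; length; allFin; cartesianProduct)
open import Data.List.Properties using (map-++; map-∘; length-map; length-++; length-tabulate)
open import Data.List.Membership.Propositional using (_∈_)
open import Data.List.Membership.Propositional.Properties using (∈-∃++; ∈-++⁺ˡ; ∈-++⁺ʳ)
open import Data.List.Relation.Unary.Any using (here; there)
open import Data.List.Relation.Unary.All using (All; []; _∷_)
import Data.List.Relation.Unary.All as All
open import Data.List.Relation.Unary.AllPairs using ([]; _∷_)
open import Data.List.Relation.Unary.Unique.Propositional using (Unique)
open import Data.List.Relation.Binary.Permutation.Propositional using (_↭_; ↭-sym)
import Data.List.Relation.Binary.Permutation.Propositional as Perm
open import Data.List.Relation.Binary.Permutation.Propositional.Properties
  using (↭-length; map⁺; shift; ∈-resp-↭)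
open import Relation.Binary using (DecidableEquality)
open import Relation.Binary.PropositionalEquality
open import Relation.Binary.Construct.Closure.ReflexiveTransitive using (ε; _◅_; _◅◅_; gmap)
open import Relation.Nullary using (¬_; Dec; yes; no; contradiction)

-- The count closes because the two kinds of target differ by a factor of 2. Every vertex is within
-- distance n of an inserted vertex, so a pebble there costs about 2ⁿ. Antipodal originals are n + 1
-- apart, which forces b to be about 2ⁿ⁺¹. Hence b c exceeds the price 2ⁿ c of c pebbles by (b - 2ⁿ)
-- c, and this surplus pays for the waste of the fibres. The numbers b and c are never computed:
-- only lower bounds enter, and these come from an unsolvable distribution with 2ⁿ⁺¹ - 1 pebbles on
-- the antipode of an original target and one on each remaining original. The obstacle is rounding.
-- Inserted vertices on an arm lose nothing, because the demand there is a multiple of a power of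
-- two. Only originals strand odd pebbles, and only the last pebble delivered to u can force traffic
-- across the opposite vertex.

≤-from : ∀ {L R} a b p → L ≤ R → a + R + p ≡ b + L → a ≤ b
≤-from {L} {R} a b p L≤R eq = +-cancelʳ-≤ R a b (begin
  a + R     ≤⟨ m≤m+n (a + R) p ⟩
  a + R + p ≡⟨ eq ⟩
  b + L     ≤⟨ +-monoʳ-≤ b L≤R ⟩
  b + R     ∎)
  where open ≤-Reasoning

-- Sums over lists

module _ {A : Set} where

  sum-map-mono : ∀ {f g : A → ℕ} → (∀ x → f x ≤ g x) →
    ∀ xs → sum (map f xs) ≤ sum (map g xs)
  sum-map-mono f≤g []       = z≤n
  sum-map-mono f≤g (x ∷ xs) = +-mono-≤ (f≤g x) (sum-map-mono f≤g xs)

  sum-map-cong : ∀ {f g : A → ℕ} → (∀ x → f x ≡ g x) →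
    ∀ xs → sum (map f xs) ≡ sum (map g xs)
  sum-map-cong f≡g []       = refl
  sum-map-cong f≡g (x ∷ xs) = cong₂ _+_ (f≡g x) (sum-map-cong f≡g xs)

  sum-map-+ : ∀ (f g : A → ℕ) xs →
    sum (map (λ x → f x + g x) xs) ≡ sum (map f xs) + sum (map g xs)
  sum-map-+ f g []       = refl
  sum-map-+ f g (x ∷ xs) rewrite sum-map-+ f g xs =
    lemma (f x) (g x) (sum (map f xs)) (sum (map g xs))
    where
    lemma : ∀ a b c d → a + b + (c + d) ≡ a + c + (b + d)
    lemma = solve-∀

  sum-map-* : ∀ c (f : A → ℕ) xs → sum (map (λ x → c * f x) xs) ≡ c * sum (map f xs)
  sum-map-* c f []       = sym (*-zeroʳ c)
  sum-map-* c f (x ∷ xs) rewrite sum-map-* c f xs =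
    sym (*-distribˡ-+ c (f x) (sum (map f xs)))

  sum-map-const : ∀ c (xs : List A) → sum (map (λ _ → c) xs) ≡ length xs * c
  sum-map-const c []       = refl
  sum-map-const c (_ ∷ xs) = cong (c +_) (sum-map-const c xs)

  ≤-sum-map : ∀ (f : A → ℕ) {x xs} → x ∈ xs → f x ≤ sum (map f xs)
  ≤-sum-map f (here refl) = m≤m+n _ _
  ≤-sum-map f (there x∈)  = ≤-trans (≤-sum-map f x∈) (m≤n+m _ _)

  pigeonhole : ∀ N (f : A → ℕ) xs → length xs * N < sum (map f xs) → ∃[ x ] N < f x
  pigeonhole N f (x ∷ xs) lt with N <? f x
  ... | yes N<fx = x , N<fx
  ... | no  N≮fx = pigeonhole N f xs
    (+-cancelˡ-< N _ _ (<-≤-trans lt (+-monoˡ-≤ _ (≮⇒≥ N≮fx))))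

  sum-map-supported : ∀ (f : A → ℕ) {x xs} → Unique xs → x ∈ xs →
    (∀ y → y ≢ x → f y ≡ 0) → sum (map f xs) ≡ f x
  sum-map-supported f {x} (x∉ ∷ _) (here refl) off =
    trans (cong (f x +_) (vanish _ x∉)) (+-identityʳ (f x))
    where
    vanish : ∀ ys → All (x ≢_) ys → sum (map f ys) ≡ 0
    vanish []       []         = refl
    vanish (y ∷ ys) (x≢y ∷ al) = cong₂ _+_ (off y (λ y≡x → x≢y (sym y≡x))) (vanish ys al)
  sum-map-supported f (y∉ ∷ uniq) (there x∈) off =
    cong₂ _+_ (off _ (All.lookup y∉ x∈)) (sum-map-supported f uniq x∈ off)

  -- Counting replaces a proof that `ys` has no duplicates. The list made of the two arms is thus
  -- recognised as an enumeration of the vertices without comparing the arms with each other.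
  unique-covered⇒↭ : ∀ {xs ys : List A} → Unique xs → (∀ {x} → x ∈ xs → x ∈ ys) →
    length ys ≤ length xs → xs ↭ ys
  unique-covered⇒↭ {[]}     {[]}    _ _ _ = Perm.refl
  unique-covered⇒↭ {x ∷ xs} {ys} (x∉ ∷ uniq) xs⊆ys len with ∈-∃++ (xs⊆ys (here refl))
  ... | us , vs , refl = Perm.trans
    (Perm.prep x (unique-covered⇒↭ uniq tail⊆ (s≤s⁻¹ (subst (_≤ _) (↭-length (shift x us vs)) len))))
    (↭-sym (shift x us vs))
    where
    tail⊆ : ∀ {y} → y ∈ xs → y ∈ us ++ vs
    tail⊆ y∈ with ∈-resp-↭ (shift x us vs) (xs⊆ys (there y∈))
    ... | here refl = contradiction refl (All.lookup x∉ y∈)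
    ... | there y∈′ = y∈′

sum-map-exchange : ∀ {A B : Set} (f : A → B → ℕ) xs ys →
  sum (map (λ x → sum (map (f x) ys)) xs) ≡ sum (map (λ y → sum (map (λ x → f x y) xs)) ys)
sum-map-exchange f []       ys = sym (trans (sum-map-const 0 ys) (*-zeroʳ (length ys)))
sum-map-exchange f (x ∷ xs) ys = trans
  (cong (sum (map (f x) ys) +_) (sum-map-exchange f xs ys))
  (sym (sum-map-+ (f x) (λ y → sum (map (λ x → f x y) xs)) ys))

-- Reachability up to discarding pebbles

module Reach (G : Graph) where

  infixl 6 _⊕_
  infix  4 _≼_ _⇝_

  _⊕_ : Distribution G → Distribution G → Distribution G
  (d ⊕ d′) z = d z + d′ z

  _≼_ : Distribution G → Distribution G → Set
  d ≼ d′ = ∀ z → d z ≤ d′ z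

  _⇝_ : Distribution G → Distribution G → Set
  d ⇝ d′ = Σ (Distribution G) λ e → (G ⊢ d ⇒* e) × d′ ≼ e

  size-⊕ : ∀ d d′ → size G (d ⊕ d′) ≡ size G d + size G d′
  size-⊕ d d′ = sum-map-+ d d′ (vertices G)

  discard : ∀ {d d′} → d′ ≼ d → d ⇝ d′
  discard {d} d′≼d = d , ε , d′≼d

  move : ∀ {d d′} → Move G d d′ → d ⇝ d′
  move {d′ = d′} m = d′ , m ◅ ε , λ _ → ≤-refl

  -- The surplus e ∸ d is untouched by the moves made on d.
  frame : ∀ {d d′} → G ⊢ d ⇒* d′ → ∀ r {e} → d ⊕ r ≼ e → e ⇝ d′ ⊕ r
  frame ε r dr≼e = discard dr≼e
  frame {d} (_◅_ {j = d₁} (x , y , adj , 2≤ , eqx , eqy , eqz) ms) r {e} dr≼e =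
    let e′ , run , le = frame ms r (λ z → +-monoʳ-≤ (d₁ z) (r≤surplus z))
    in  e′ , step ◅ run , le
    where
    d≤e : d ≼ e
    d≤e z = ≤-trans (m≤m+n (d z) (r z)) (dr≼e z)
    surplus : Distribution G
    surplus z = e z ∸ d z
    r≤surplus : r ≼ surplus
    r≤surplus z = subst (_≤ surplus z) (m+n∸m≡n (d z) (r z)) (∸-monoˡ-≤ (d z) (dr≼e z))
    restore : ∀ z → d z + surplus z ≡ e z
    restore z = m+[n∸m]≡n (d≤e z)
    swap₂₃ : ∀ a b c → a + b + c ≡ a + c + b
    swap₂₃ = solve-∀
    step : Move G e (d₁ ⊕ surplus)
    step = x , y , adj , ≤-trans 2≤ (d≤e x)
         , trans (swap₂₃ (d₁ x) _ 2) (trans (cong (_+ surplus x) eqx) (restore x))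
         , trans (cong (_+ surplus y) eqy)
             (trans (swap₂₃ (d y) 1 _) (cong (_+ 1) (restore y)))
         , λ z z≢x z≢y → trans (cong (_+ surplus z) (eqz z z≢x z≢y)) (restore z)

  ⇝-trans : ∀ {d d′ d″} → d ⇝ d′ → d′ ⇝ d″ → d ⇝ d″
  ⇝-trans (e , run , d′≼e) (e′ , run′ , d″≼e′) =
    let f , run″ , e′≼f = frame run′ (λ _ → 0) (λ z → ≤-trans (≤-reflexive (+-identityʳ _)) (d′≼e z))
    in  f , run ◅◅ run″ , λ z → ≤-trans (d″≼e′ z) (m+n≤o⇒m≤o _ (e′≼f z))

  ⇝-⊕ : ∀ {d₁ d₁′ d₂ d₂′} → d₁ ⇝ d₁′ → d₂ ⇝ d₂′ → d₁ ⊕ d₂ ⇝ d₁′ ⊕ d₂′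
  ⇝-⊕ {d₁} {d₁′} {d₂} {d₂′} (e₁ , run₁ , le₁) (e₂ , run₂ , le₂) = ⇝-trans
    (frame run₁ d₂ (λ _ → ≤-refl))
    (⇝-trans (frame run₂ e₁ (λ z → ≤-reflexive (+-comm (d₂ z) (e₁ z))))
             (discard λ z → ≤-trans (+-mono-≤ (le₁ z) (le₂ z)) (≤-reflexive (+-comm (e₁ z) (e₂ z)))))

  ⨁ : ∀ {I : Set} → List I → (I → Distribution G) → Distribution G
  ⨁ is R z = sum (map (λ i → R i z) is)

  ⇝-⨁ : ∀ {I : Set} {R R′ : I → Distribution G} → (∀ i → R i ⇝ R′ i) →
    ∀ is → ⨁ is R ⇝ ⨁ is R′
  ⇝-⨁ R⇝R′ []       = discard λ _ → ≤-refl
  ⇝-⨁ R⇝R′ (i ∷ is) = ⇝-⊕ (R⇝R′ i) (⇝-⨁ R⇝R′ is)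

  module Points (_≟_ : DecidableEquality (V G)) where

    point : V G → ℕ → Distribution G
    point x k z with z ≟ x
    ... | yes _ = k
    ... | no  _ = 0

    point-at : ∀ x k → point x k x ≡ k
    point-at x k with x ≟ x
    ... | yes _  = refl
    ... | no x≢x = contradiction refl x≢x

    point-off : ∀ {x z} k → z ≢ x → point x k z ≡ 0
    point-off {x} {z} k z≢x with z ≟ x
    ... | yes z≡x = contradiction z≡x z≢x
    ... | no _    = refl

    point-+ : ∀ x k l z → point x (k + l) z ≡ point x k z + point x l z
    point-+ x k l z with z ≟ x
    ... | yes _ = refl
    ... | no _  = refl

    point-mono : ∀ x {k l} → k ≤ l → point x k ≼ point x l
    point-mono x k≤l z with z ≟ x
    ... | yes _ = k≤l
    ... | no _  = z≤n

    point-≼ : ∀ {x k} {d : Distribution G} → k ≤ d x → point x k ≼ d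
    point-≼ {x} k≤dx z with z ≟ x
    ... | yes refl = k≤dx
    ... | no _     = z≤n

    size-point : ∀ x k → size G (point x k) ≡ k
    size-point x k = trans
      (sum-map-supported (point x k) (unique G) (complete G x) (λ _ → point-off k))
      (point-at x k)

    -- Splits `d` into one heap per vertex, in whatever order suits the geometry, so that the heaps
    -- can be moved independently.
    ⨁-points : ∀ d {xs} → vertices G ↭ xs → ⨁ xs (λ x → point x (d x)) ≼ d
    ⨁-points d {xs} perm z = ≤-reflexive (begin
      sum (map f xs)           ≡⟨ sum-↭ (map⁺ f (↭-sym perm)) ⟩
      sum (map f (vertices G)) ≡⟨ sum-map-supported f (unique G) (complete G z)
                                    (λ x x≢z → point-off (d x) (λ z≡x → x≢z (sym z≡x))) ⟩
      point z (d z) z          ≡⟨ point-at z (d z) ⟩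
      d z                      ∎)
      where
      open ≡-Reasoning
      f : V G → ℕ
      f x = point x (d x) z

    move-point : ∀ {x y} → Adj G x y → x ≢ y → point x 2 ⇝ point y 1
    move-point {x} {y} adj x≢y = move
      ( x , y , adj , ≤-reflexive (sym (point-at x 2))
      , trans (cong (_+ 2) (point-off 1 x≢y)) (sym (point-at x 2))
      , trans (point-at y 1) (sym (cong (_+ 1) (point-off 2 (λ y≡x → x≢y (sym y≡x)))))
      , λ z z≢x z≢y → trans (point-off 1 z≢y) (sym (point-off 2 z≢x)))

    push : ∀ {x y} → Adj G x y → x ≢ y → ∀ k {N} → 2 * k ≤ N → point x N ⇝ point y k
    push {x} {y} adj x≢y zero    _  = discard (point-≼ z≤n)
    push {x} {y} adj x≢y (suc k) le = ⇝-trans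
      (discard {d′ = point x 2 ⊕ point x (2 * k)} λ z → ≤-trans
        (≤-reflexive (trans (sym (point-+ x 2 (2 * k) z))
                            (cong (λ n → point x n z) (sym (*-suc 2 k)))))
        (point-mono x le z))
      (⇝-trans (⇝-⊕ (move-point adj x≢y) (push adj x≢y k ≤-refl))
        (discard λ z → ≤-reflexive (point-+ y 1 k z)))

    remove : ∀ x k (d : Distribution G) → k ≤ d x →
      Σ (Distribution G) λ d₀ → ∀ z → d z ≡ d₀ z + point x k z
    remove x k d k≤dx =
      (λ z → d z ∸ point x k z) , λ z → sym (m∸n+n≡m (point-≼ k≤dx z))

    ⇝⇒Solvable : ∀ {d v k} → 1 ≤ k → d ⇝ point v k → Solvable G d v
    ⇝⇒Solvable {v = v} {k} 1≤k (e , run , le) =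
      e , run , ≤-trans 1≤k (subst (_≤ e v) (point-at v k) (le v))

    Solvable⇒⇝ : ∀ {d v} → Solvable G d v → d ⇝ point v 1
    Solvable⇒⇝ (e , run , 1≤ev) = e , run , point-≼ 1≤ev

    -- `AllSolvable` speaks of exactly N pebbles; dropping surplus pebbles one by one makes it
    -- usable for larger distributions.
    shrink : ∀ {N} k d → size G d ≡ k + N → Σ (Distribution G) λ d₀ → size G d₀ ≡ N × d₀ ≼ d
    shrink zero    d eq = d , eq , λ _ → ≤-refl
    shrink {N} (suc k) d eq
      with pigeonhole 0 d (vertices G)
             (subst₂ _<_ (sym (*-zeroʳ (length (vertices G)))) (sym eq) (s≤s z≤n))
    ... | x , 0<dx with remove x 1 d 0<dx
    ... | d₁ , split with shrink k d₁ (+-cancelʳ-≡ 1 _ _ (begin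
            size G d₁ + 1                  ≡⟨ cong (size G d₁ +_) (size-point x 1) ⟨
            size G d₁ + size G (point x 1) ≡⟨ size-⊕ d₁ (point x 1) ⟨
            size G (d₁ ⊕ point x 1)        ≡⟨ sum-map-cong split (vertices G) ⟨
            size G d                       ≡⟨ eq ⟩
            suc (k + N)                    ≡⟨ +-comm 1 (k + N) ⟩
            k + N + 1                      ∎))
      where open ≡-Reasoning
    ... | d₀ , size≡ , d₀≼d₁ = d₀ , size≡ ,
      λ z → ≤-trans (d₀≼d₁ z) (subst (d₁ z ≤_) (sym (split z)) (m≤m+n _ _))

    AllSolvable⇒⇝ : ∀ {v N} → AllSolvable G v N → ∀ d → N ≤ size G d → d ⇝ point v 1
    AllSolvable⇒⇝ {v} {N} solv d N≤size with shrink (size G d ∸ N) d (sym (m∸n+n≡m N≤size))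
    ... | d₀ , size≡ , d₀≼d = ⇝-trans (discard d₀≼d) (Solvable⇒⇝ (solv d₀ size≡))

-- Routing pebbles onto the two arms

-- Two arms carry A and B pebbles' worth at their far ends, where M pebbles buy
-- one pebble on the target.  From s pairs on one neighbour of the right far
-- end, s₁ go directly to it and s₂ to the top vertex; likewise t on the left.
-- The T + s₂ + t₂ pebbles on top then yield z₁ to the right, z₂ to the left.
record Routing (M k A B s t T : ℕ) : Set where
  constructor routing
  field
    s₁ s₂ t₁ t₂ z₁ z₂ kᵣ kₗ : ℕ
    s-split : s₁ + s₂ ≤ s
    t-split : t₁ + t₂ ≤ t
    top     : 2 * (z₁ + z₂) ≤ s₂ + t₂ + T
    right   : kᵣ * M ≤ A + (s₁ + z₁)
    left    : kₗ * M ≤ B + (t₁ + z₂)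
    total   : k ≤ kᵣ + kₗ

mirror : ∀ {M k A B s t T} → Routing M k B A t s T → Routing M k A B s t T
mirror {k = k} {T = T} (routing s₁ s₂ t₁ t₂ z₁ z₂ kᵣ kₗ p q top r l tot) =
  routing t₁ t₂ s₁ s₂ z₂ z₁ kₗ kᵣ q p
    (subst₂ _≤_ (cong (2 *_) (+-comm z₁ z₂)) (cong (_+ T) (+-comm s₂ t₂)) top)
    l r (subst (k ≤_) (+-comm kᵣ kₗ) tot)

-- Three times the requirement that the total, a pair counting 2, be at least 2Mk + 2M/3 - 1. The
-- third comes from the balanced case A = B = T = 0 with s and t near 2M/3: then s + t/2, all that
-- one side can receive, just misses M.
Enough : ℕ → ℕ → ℕ → ℕ → ℕ → ℕ → ℕ → Set
Enough M k A B s t T = 6 * M * k + 2 * M ≤ 3 * (A + B + 2 * s + 2 * t + T) + 3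

Routable : ℕ → ℕ → Set
Routable M k = ∀ A B s t T → Enough M k A B s t T → Routing M k A B s t T

private
  -- The induction on k: a purchase that uses up at most 2M of the total leaves enough for the
  -- remaining pebbles.
  spend : ∀ {M k N N′} x → 6 * M * suc k + 2 * M ≤ 3 * N + 3 → N ≡ x + N′ → x ≤ 2 * M →
    6 * M * k + 2 * M ≤ 3 * N′ + 3
  spend {M} {k} {N} {N′} x enough refl x≤ =
    ≤-from _ _ 0 (+-mono-≤ enough (*-monoʳ-≤ 3 x≤)) (lemma M k N′ x)
    where
    lemma : ∀ M k N′ x → 6 * M * k + 2 * M + (3 * (x + N′) + 3 + 3 * (2 * M)) + 0
                       ≡ 3 * N′ + 3 + (6 * M * suc k + 2 * M + 3 * x)
    lemma = solve-∀

  buy-from-arm : ∀ {M k A B s t T} → Routing M k A B s t T →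
    Routing M (suc k) (M + A) B s t T
  buy-from-arm {M} {A = A} (routing s₁ s₂ t₁ t₂ z₁ z₂ kᵣ kₗ p q top r l tot) =
    routing s₁ s₂ t₁ t₂ z₁ z₂ (suc kᵣ) kₗ p q top
    (≤-trans (+-monoʳ-≤ M r) (≤-reflexive (sym (+-assoc M A _)))) l (s≤s tot)

  buy-direct : ∀ {k A B s t T} s₀ → Routing (A + s₀) k 0 B s t T →
    Routing (A + s₀) (suc k) A B (s₀ + s) t T
  buy-direct {A = A} s₀ (routing s₁ s₂ t₁ t₂ z₁ z₂ kᵣ kₗ p q top r l tot) =
    routing (s₀ + s₁) s₂ t₁ t₂ z₁ z₂ (suc kᵣ) kₗ
      (≤-trans (≤-reflexive (+-assoc s₀ s₁ s₂)) (+-monoʳ-≤ s₀ p)) q top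
      (≤-trans (+-monoʳ-≤ (A + s₀) r) (≤-reflexive (lemma A s₀ s₁ z₁))) l (s≤s tot)
    where
    lemma : ∀ A s₀ s₁ z₁ → A + s₀ + (s₁ + z₁) ≡ A + (s₀ + s₁ + z₁)
    lemma = solve-∀

  buy-from-top : ∀ {k A B s t T} z → Routing (A + s + z) k 0 B 0 t T →
    Routing (A + s + z) (suc k) A B s t (2 * z + T)
  buy-from-top {A = A} {s = s} {T = T} z (routing s₁ s₂ t₁ t₂ z₁ z₂ kᵣ kₗ p q top r l tot) =
    routing (s + s₁) s₂ t₁ t₂ (z + z₁) z₂ (suc kᵣ) kₗ
      (≤-trans (≤-reflexive (+-assoc s s₁ s₂)) (≤-trans (+-monoʳ-≤ s p) (≤-reflexive (+-identityʳ s)))) q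
      (≤-from _ _ 0 top (lemma₁ z z₁ z₂ s₂ t₂ T))
      (≤-trans (+-monoʳ-≤ (A + s + z) r) (≤-reflexive (lemma₂ A s z s₁ z₁))) l (s≤s tot)
    where
    lemma₁ : ∀ z z₁ z₂ s₂ t₂ T → 2 * (z + z₁ + z₂) + (s₂ + t₂ + T) + 0
                               ≡ s₂ + t₂ + (2 * z + T) + 2 * (z₁ + z₂)
    lemma₁ = solve-∀
    lemma₂ : ∀ A s z s₁ z₁ → A + s + z + (s₁ + z₁) ≡ A + (s + s₁ + (z + z₁))
    lemma₂ = solve-∀

  2*-shortfall : ∀ {M} X z T → X + z ≡ M → 2 * M ≤ 2 * X + T → 2 * z ≤ T
  2*-shortfall X z T refl le = ≤-from _ _ 0 le (lemma X z T)
    where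
    lemma : ∀ X z T → 2 * z + (2 * X + T) + 0 ≡ T + 2 * (X + z)
    lemma = solve-∀

  -- The M units are taken from the cheapest source first: the arm at price 1, then pairs moved
  -- directly and pairs of top pebbles, both at price 2. So the cost never exceeds 2M.
  buy-right : ∀ {M k} A B s t T → Routable M k → 2 * M ≤ 2 * (A + s) + T →
    Enough M (suc k) A B s t T → Routing M (suc k) A B s t T
  buy-right {M} {k} A B s t T rec cheap enough with M ≤? A
  ... | yes M≤A with m≤n⇒∃[o]m+o≡n M≤A
  ...   | A′ , refl = buy-from-arm (rec A′ B s t T (spend {M} {k} M enough (lemma M A′ B s t T) (m≤n*m M 2)))
    where
    lemma : ∀ M A B s t T → M + A + B + 2 * s + 2 * t + T ≡ M + (A + B + 2 * s + 2 * t + T)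
    lemma = solve-∀
  buy-right {M} {k} A B s t T rec cheap enough | no M≰A with m≤n⇒∃[o]m+o≡n (<⇒≤ (≰⇒> M≰A))
  ... | s₀ , refl with s₀ ≤? s
  ...   | yes s₀≤s with m≤n⇒∃[o]m+o≡n s₀≤s
  ...     | s′ , refl = buy-direct s₀ (rec 0 B s′ t T
      (spend {A + s₀} {k} (A + 2 * s₀) enough (lemma A B s₀ s′ t T) (≤-from _ _ A ≤-refl (lemma′ A s₀))))
    where
    lemma : ∀ A B s₀ s t T → A + B + 2 * (s₀ + s) + 2 * t + T
                           ≡ A + 2 * s₀ + (B + 2 * s + 2 * t + T)
    lemma = solve-∀
    lemma′ : ∀ A s₀ → A + 2 * s₀ + 0 + A ≡ 2 * (A + s₀) + 0
    lemma′ = solve-∀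
  buy-right {M} {k} A B s t T rec cheap enough | no M≰A | s₀ , refl | no s₀≰s
    with m≤n⇒∃[o]m+o≡n (<⇒≤ (≰⇒> s₀≰s))
  ... | z , refl with m≤n⇒∃[o]m+o≡n (2*-shortfall (A + s) z T (+-assoc A s z) cheap)
  ...   | T′ , refl = subst (λ M → Routing M (suc k) A B s t (2 * z + T′)) (+-assoc A s z)
      (buy-from-top z (subst (λ M → Routing M k 0 B 0 t T′) (sym (+-assoc A s z)) (rec 0 B 0 t T′
        (spend {A + (s + z)} {k} (A + 2 * s + 2 * z) enough (lemma A B s t z T′) (≤-from _ _ A ≤-refl (lemma′ A s z))))))
    where
    lemma : ∀ A B s t z T → A + B + 2 * s + 2 * t + (2 * z + T)
                          ≡ A + 2 * s + 2 * z + (B + 0 + 2 * t + T)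
    lemma = solve-∀
    lemma′ : ∀ A s z → A + 2 * s + 2 * z + 0 + A ≡ 2 * (A + (s + z)) + 0
    lemma′ = solve-∀

  Enough-mirror : ∀ {M k} A B s t T → Enough M k A B s t T → Enough M k B A t s T
  Enough-mirror {M} {k} A B s t T = subst (6 * M * k + 2 * M ≤_) (lemma A B s t T)
    where
    lemma : ∀ A B s t T → 3 * (A + B + 2 * s + 2 * t + T) + 3 ≡ 3 * (B + A + 2 * t + 2 * s + T) + 3
    lemma = solve-∀

  -- Sending t over the top halves it, which is affordable only for the last pebble.
  last-right : ∀ {M} A B s t T → 2 * M ≤ 2 * (A + s) + (t + T) → Routing M 1 A B s t T
  last-right {M} A B s t T cheap with M ≤? A + s
  ... | yes M≤ = routing s 0 0 0 0 0 1 0 (≤-reflexive (+-identityʳ s)) z≤n z≤n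
      (subst₂ _≤_ (sym (+-identityʳ M)) (cong (A +_) (sym (+-identityʳ s))) M≤) z≤n ≤-refl
  ... | no M≰ with m≤n⇒∃[o]m+o≡n (<⇒≤ (≰⇒> M≰))
  ...   | z , refl = routing s 0 0 t z 0 1 0 (≤-reflexive (+-identityʳ s)) ≤-refl
      (subst (λ z → 2 * z ≤ t + T) (sym (+-identityʳ z)) (2*-shortfall (A + s) z (t + T) refl cheap))
      (≤-reflexive (trans (+-identityʳ _) (+-assoc A s z))) z≤n ≤-refl

  -- The two shortfalls add up to a total of at most 4M - 2, whereas two pebbles ask for 4M + 2M/3 -
  -- 1.
  dear⇒k≡1 : ∀ {M k} A B s t T → 2 * (A + s) + T < 2 * M → 2 * (B + t) + T < 2 * M →
    ¬ Enough M (2 + k) A B s t T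
  dear⇒k≡1 {M} {k} A B s t T r l enough = n≮n 0
    (≤-from 1 0 (2 + 6 * M * k + 2 * M + 3 * A + 3 * B + 3 * T)
      (+-mono-≤ enough (*-monoʳ-≤ 3 (+-mono-≤ r l))) (lemma M k A B s t T))
    where
    lemma : ∀ M k A B s t T →
      1 + (3 * (A + B + 2 * s + 2 * t + T) + 3 + 3 * (2 * M + 2 * M))
        + (2 + 6 * M * k + 2 * M + 3 * A + 3 * B + 3 * T)
      ≡ 0 + (6 * M * (2 + k) + 2 * M + 3 * (suc (2 * (A + s) + T) + suc (2 * (B + t) + T)))
    lemma = solve-∀

  -- Twice the sum of the shortfalls bounds three times the total by 8M - 4, while `Enough` asks for
  -- 8M - 3: the constant is sharp for this argument.
  dear⇒¬Enough-1 : ∀ {M} A B s t T → 2 * (A + s) + (t + T) < 2 * M → 2 * (B + t) + (s + T) < 2 * M →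
    ¬ Enough M 1 A B s t T
  dear⇒¬Enough-1 {M} A B s t T r l enough = n≮n 0
    (≤-from 1 0 (A + B + T)
      (+-mono-≤ enough (*-monoʳ-≤ 2 (+-mono-≤ r l))) (lemma M A B s t T))
    where
    lemma : ∀ M A B s t T →
      1 + (3 * (A + B + 2 * s + 2 * t + T) + 3 + 2 * (2 * M + 2 * M)) + (A + B + T)
      ≡ 0 + (6 * M * 1 + 2 * M + 2 * (suc (2 * (A + s) + (t + T)) + suc (2 * (B + t) + (s + T))))
    lemma = solve-∀

route : ∀ M k → Routable M k
route M zero    A B s t T _ = routing 0 0 0 0 0 0 0 0 z≤n z≤n z≤n z≤n z≤n z≤n
route M (suc k) A B s t T enough with 2 * M ≤? 2 * (A + s) + T
... | yes cheap = buy-right A B s t T (route M k) cheap enough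
... | no dear with 2 * M ≤? 2 * (B + t) + T
...   | yes cheap = mirror (buy-right B A t s T (route M k) cheap (Enough-mirror {M} {suc k} A B s t T enough))
route M (suc (suc k)) A B s t T enough | no dear | no dear′ =
  contradiction enough (dear⇒k≡1 {M} {k} A B s t T (≰⇒> dear) (≰⇒> dear′))
route M 1 A B s t T enough | no _ | no _ with 2 * M ≤? 2 * (A + s) + (t + T)
... | yes cheap = last-right A B s t T cheap
... | no dear with 2 * M ≤? 2 * (B + t) + (s + T)
...   | yes cheap = mirror (last-right B A t s T cheap)
...   | no dear′ = contradiction enough (dear⇒¬Enough-1 {M} A B s t T (≰⇒> dear) (≰⇒> dear′))

-- Middle graphs of cycles

_≟ᴹ_ : ∀ {k} → DecidableEquality (V (MiddleCycle k))
_≟ᴹ_ = Sum.≡-dec Fin._≟_ Fin._≟_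

MAdj⇒≢ : ∀ {k} {x y : V (MiddleCycle k)} → Adj (MiddleCycle k) x y → x ≢ y
MAdj⇒≢ {x = inj₂ e} (e≢e , _) refl = e≢e refl

length-MiddleCycle : ∀ k → length (vertices (MiddleCycle k)) ≡ 2 * suc k
length-MiddleCycle k = begin
  length (map inj₁ is ++ map inj₂ is)        ≡⟨ length-++ (map inj₁ is) ⟩
  length (map {B = V (MiddleCycle k)} inj₁ is) + length (map {B = V (MiddleCycle k)} inj₂ is)
    ≡⟨ cong₂ _+_ (length-map inj₁ is) (length-map inj₂ is) ⟩
  length is + length is                      ≡⟨ cong₂ _+_ len len ⟩
  suc k + suc k                              ≡⟨ cong (suc k +_) (sym (+-identityʳ (suc k))) ⟩
  2 * suc k                                  ∎
  where
  open ≡-Reasoning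
  is = allFin (suc k)
  len : length is ≡ suc k
  len = length-tabulate {n = suc k} (λ i → i)

toℕ-next : ∀ {k} (i : Fin (suc k)) → toℕ (next i) ≡ suc (toℕ i) % suc k
toℕ-next {k} i = Fin.toℕ-fromℕ< (m%n<n (suc (toℕ i)) (suc k))

suc-%-% : ∀ a d .{{_ : NonZero d}} → suc (a % d) % d ≡ suc a % d
suc-%-% a d = begin
  suc (a % d) % d         ≡⟨ %-congˡ {o = d} (+-comm 1 (a % d)) ⟩
  (a % d + 1) % d         ≡⟨ %-distribˡ-+ (a % d) 1 d ⟩
  (a % d % d + 1 % d) % d ≡⟨ %-congˡ {o = d} (cong (_+ 1 % d) (m%n%n≡m%n a d)) ⟩
  (a % d + 1 % d) % d     ≡⟨ %-distribˡ-+ a 1 d ⟨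
  (a + 1) % d             ≡⟨ %-congˡ {o = d} (+-comm a 1) ⟩
  suc a % d               ∎
  where open ≡-Reasoning

-- Numbering the cycle from a chosen edge

module Rotation {k} (e : Fin (suc k)) where

  K : ℕ
  K = suc k

  rot : ℕ → Fin K
  rot i = fromℕ< (m%n<n (toℕ e + i) K)

  toℕ-rot : ∀ i → toℕ (rot i) ≡ (toℕ e + i) % K
  toℕ-rot i = Fin.toℕ-fromℕ< (m%n<n (toℕ e + i) K)

  rot-zero : rot 0 ≡ e
  rot-zero = Fin.toℕ-injective (begin
    toℕ (rot 0)       ≡⟨ toℕ-rot 0 ⟩
    (toℕ e + 0) % K   ≡⟨ cong (_% K) (+-identityʳ (toℕ e)) ⟩
    toℕ e % K         ≡⟨ m<n⇒m%n≡m (Fin.toℕ<n e) ⟩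
    toℕ e             ∎)
    where open ≡-Reasoning

  rot-period : rot K ≡ e
  rot-period = Fin.toℕ-injective (begin
    toℕ (rot K)     ≡⟨ toℕ-rot K ⟩
    (toℕ e + K) % K ≡⟨ [m+n]%n≡m%n (toℕ e) K ⟩
    toℕ e % K       ≡⟨ m<n⇒m%n≡m (Fin.toℕ<n e) ⟩
    toℕ e           ∎)
    where open ≡-Reasoning

  next-rot : ∀ i → next (rot i) ≡ rot (suc i)
  next-rot i = Fin.toℕ-injective (begin
    toℕ (next (rot i))        ≡⟨ toℕ-next (rot i) ⟩
    suc (toℕ (rot i)) % K     ≡⟨ cong (λ a → suc a % K) (toℕ-rot i) ⟩
    suc ((toℕ e + i) % K) % K ≡⟨ suc-%-% (toℕ e + i) K ⟩
    suc (toℕ e + i) % K       ≡⟨ cong (_% K) (sym (+-suc (toℕ e) i)) ⟩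
    (toℕ e + suc i) % K       ≡⟨ toℕ-rot (suc i) ⟨
    toℕ (rot (suc i))         ∎)
    where open ≡-Reasoning

  rot-surjective : ∀ x → ∃[ i ] i < K × x ≡ rot i
  rot-surjective x = j % K , m%n<n j K , Fin.toℕ-injective (sym (begin
    toℕ (rot (j % K))             ≡⟨ toℕ-rot (j % K) ⟩
    (toℕ e + j % K) % K           ≡⟨ %-distribˡ-+ (toℕ e) (j % K) K ⟩
    (toℕ e % K + j % K % K) % K   ≡⟨ cong (λ a → (toℕ e % K + a) % K) (m%n%n≡m%n j K) ⟩
    (toℕ e % K + j % K) % K       ≡⟨ %-distribˡ-+ (toℕ e) j K ⟨
    (toℕ e + j) % K               ≡⟨ cong (_% K) e+j≡x+K ⟩
    (toℕ x + K) % K               ≡⟨ [m+n]%n≡m%n (toℕ x) K ⟩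
    toℕ x % K                     ≡⟨ m<n⇒m%n≡m (Fin.toℕ<n x) ⟩
    toℕ x                         ∎))
    where
    open ≡-Reasoning
    j : ℕ
    j = toℕ x + (K ∸ toℕ e)
    swap₁₂ : ∀ a b c → a + (b + c) ≡ b + (a + c)
    swap₁₂ = solve-∀
    e+j≡x+K : toℕ e + j ≡ toℕ x + K
    e+j≡x+K = trans (swap₁₂ (toℕ e) (toℕ x) _) (cong (toℕ x +_) (m+[n∸m]≡n (<⇒≤ (Fin.toℕ<n e))))

e≢next : ∀ {k} → 2 ≤ suc k → (e : Fin (suc k)) → e ≢ next e
e≢next {k} 2≤K e e≡next with m≤n⇒m<n∨m≡n (Fin.toℕ<n e)
... | inj₁ e+1<K = 1+n≢n (sym (trans (trans (cong toℕ e≡next) (toℕ-next e)) (m<n⇒m%n≡m e+1<K)))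
-- On wrapping around, `next e` is 0; if `e` were equal to it, the cycle would have a single vertex.
... | inj₂ e+1≡K = contradiction
  (trans (cong suc (sym (trans (trans (cong toℕ e≡next) (toℕ-next e))
                               (trans (cong (_% suc k) e+1≡K) (n%n≡0 (suc k)))))) e+1≡K)
  (<⇒≢ 2≤K)

n≤1+2*[n/2] : ∀ c → c ≤ suc (2 * (c / 2))
n≤1+2*[n/2] c = begin
  c                    ≡⟨ m≡m%n+[m/n]*n c 2 ⟩
  c % 2 + c / 2 * 2    ≤⟨ +-mono-≤ (s≤s⁻¹ (m%n<n c 2)) (≤-reflexive (*-comm (c / 2) 2)) ⟩
  suc (2 * (c / 2))    ∎
  where open ≤-Reasoning

2*[n/2]≤n : ∀ c → 2 * (c / 2) ≤ c
2*[n/2]≤n c = ≤-trans (≤-reflexive (*-comm 2 (c / 2))) (m/n*n≤m c 2)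

2*m≤1+2*n⇒m≤n : ∀ m n → 2 * m ≤ suc (2 * n) → m ≤ n
2*m≤1+2*n⇒m≤n m n le = s≤s⁻¹ (*-cancelˡ-< 2 m (suc n)
  (≤-trans (s≤s le) (≤-reflexive (sym (*-suc 2 n)))))

-- An arm consists of inserted vertices r 0, r 1, …, and of original vertices
-- w i adjacent to r i and r (suc i).
module Arm {k} (r w : ℕ → V (MiddleCycle k)) (β : ℕ) (d : Distribution (MiddleCycle k)) where

  open Reach (MiddleCycle k)
  open Points _≟ᴹ_

  arm : ℕ → List (V (MiddleCycle k))
  arm zero    = []
  arm (suc j) = r (suc j) ∷ w j ∷ arm j

  load : ℕ → Distribution (MiddleCycle k)
  load j = ⨁ (arm j) (λ x → point x (d x))

  -- The unit is a pebble on `r j`, and the value doubles with each step towards `r 0`. A pair on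
  -- `w i` counts as the one pebble it puts on `r i`, so rounding occurs at originals only.
  worth : ℕ → ℕ
  worth zero    = β
  worth (suc j) = 2 * worth j + d (r (suc j)) + 2 * (d (w j) / 2)

  r∈arm : ∀ {i} j → 0 < i → i ≤ j → r i ∈ arm j
  r∈arm zero    0<i i≤0 = contradiction i≤0 (<⇒≱ 0<i)
  r∈arm (suc j) 0<i i≤1+j with m≤n⇒m<n∨m≡n i≤1+j
  ... | inj₁ i<1+j = there (there (r∈arm j 0<i (s≤s⁻¹ i<1+j)))
  ... | inj₂ refl  = here refl

  w∈arm : ∀ {i} j → i < j → w i ∈ arm j
  w∈arm (suc j) i<1+j with m≤n⇒m<n∨m≡n (s≤s⁻¹ i<1+j)
  ... | inj₁ i<j  = there (there (w∈arm j i<j))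
  ... | inj₂ refl = there (here refl)

  length-arm : ∀ j → length (arm j) ≡ 2 * j
  length-arm zero    = refl
  length-arm (suc j) = trans (cong (2 +_) (length-arm j)) (sym (*-suc 2 j))

  -- Every pebble counts at least 1 in `worth`, except for at most one odd pebble on each of the j
  -- originals.
  arm-size : ∀ j → β + sum (map d (arm j)) ≤ worth j + j
  arm-size zero    = ≤-refl
  arm-size (suc j) = ≤-from _ _ (worth j) (+-mono-≤ (arm-size j) (n≤1+2*[n/2] (d (w j))))
    (lemma β (d (r (suc j))) (d (w j)) (d (w j) / 2) (sum (map d (arm j))) (worth j) j)
    where
    lemma : ∀ β a c h S W j →
      β + (a + (c + S)) + (W + j + suc (2 * h)) + W ≡ 2 * W + a + 2 * h + suc j + (β + S + c)
    lemma = solve-∀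

  -- Halving the heap on `r (suc j)`, incoming `α` included, loses nothing: the demand
  -- `m * 2 ^ suc j` is even, so an odd pebble there could not have helped to meet it.
  collect : ∀ j → (∀ i → i < j → Adj (MiddleCycle k) (r (suc i)) (r i)) →
    (∀ i → i < j → Adj (MiddleCycle k) (w i) (r i)) →
    ∀ α m → m * 2 ^ j ≤ worth j + α →
    point (r 0) β ⊕ load j ⊕ point (r j) α ⇝ point (r 0) m
  collect zero    _  _  α m le = discard λ z → ≤-trans
    (point-mono (r 0) (subst (_≤ β + α) (*-identityʳ m) le) z)
    (≤-reflexive (trans (point-+ (r 0) β α z) (cong (_+ point (r 0) α z) (sym (+-identityʳ _)))))
  collect (suc j) rr wr α m le = ⇝-trans
    (⇝-trans
      (discard {d′ = point (r 0) β ⊕ load j ⊕ (point (r (suc j)) (a + α) ⊕ point (w j) c)} λ z →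
        ≤-reflexive (trans
          (cong (λ n → point (r 0) β z + load j z + (n + point (w j) c z)) (point-+ (r (suc j)) a α z))
          (lemma₁ (point (r 0) β z) (load j z) (point (r (suc j)) a z) (point (r (suc j)) α z) (point (w j) c z))))
      (⇝-trans
        (⇝-⊕ {d₁ = point (r 0) β ⊕ load j} (discard λ _ → ≤-refl)
             (⇝-⊕ (push (rr j ≤-refl) (MAdj⇒≢ (rr j ≤-refl)) h (2*[n/2]≤n (a + α)))
                  (push (wr j ≤-refl) (MAdj⇒≢ (wr j ≤-refl)) h′ (2*[n/2]≤n c))))
        (discard {d′ = point (r 0) β ⊕ load j ⊕ point (r j) (h + h′)} λ z →
          +-monoʳ-≤ _ (≤-reflexive (point-+ (r j) h h′ z)))))
    (collect j (λ i i<j → rr i (m<n⇒m<1+n i<j)) (λ i i<j → wr i (m<n⇒m<1+n i<j)) (h + h′) m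
      (2*m≤1+2*n⇒m≤n _ _ (≤-from _ _ 0 (+-mono-≤ le (n≤1+2*[n/2] (a + α)))
        (lemma₂ m (2 ^ j) (worth j) a h h′ α))))
    where
    a c h h′ : ℕ
    a  = d (r (suc j))
    c  = d (w j)
    h  = (a + α) / 2
    h′ = c / 2
    lemma₁ : ∀ b l a α c → b + l + (a + α + c) ≡ b + (a + (c + l)) + α
    lemma₁ = solve-∀
    lemma₂ : ∀ m P W a h h′ α →
      2 * (m * P) + (2 * W + a + 2 * h′ + α + suc (2 * h)) + 0
      ≡ suc (2 * (W + (h + h′))) + (m * (2 * P) + (a + α))
    lemma₂ = solve-∀

-- Delivering pebbles to an inserted vertex

module _ {k n′} (K≡2n : suc k ≡ 2 * suc n′) (e : Fin (suc k)) where

  open Reach (MiddleCycle k)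
  open Points _≟ᴹ_
  open Rotation e

  private
    n M : ℕ
    n = suc n′
    M = 2 ^ n′

    -- `r` runs forward and `l` backward from `e`. They meet at the top `r n`, which is `l n`
    -- because K = 2n; its two original neighbours are `w n′` and `w′ n′`.
    r w l w′ : ℕ → V (MiddleCycle k)
    r i  = inj₂ (rot i)
    w i  = inj₁ (rot (suc i))
    l i  = inj₂ (rot (K ∸ i))
    w′ i = inj₁ (rot (K ∸ i))

    2≤K : 2 ≤ K
    2≤K = subst (2 ≤_) (sym K≡2n) (*-monoʳ-≤ 2 (s≤s z≤n))

    n<K : n < K
    n<K = subst (n <_) (sym K≡2n) (1+a<2+2a n′)
      where
      1+a<2+2a : ∀ n′ → suc n′ < 2 * suc n′
      1+a<2+2a n′ = ≤-from _ _ n′ ≤-refl (lemma n′)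
        where
        lemma : ∀ n′ → suc (suc n′) + 0 + n′ ≡ 2 * suc n′ + 0
        lemma = solve-∀

    K∸n≡n : K ∸ n ≡ n
    K∸n≡n = trans (cong (_∸ n) (trans K≡2n (cong (n +_) (+-identityʳ n)))) (m+n∸n≡m n n)

    next-back : ∀ {i} → i < K → rot (K ∸ i) ≡ next (rot (K ∸ suc i))
    next-back {i} i<K = sym (trans (next-rot (K ∸ suc i)) (cong rot (sym (∸-suc′ i<K))))
      where
      ∸-suc′ : ∀ {m i} → i < m → m ∸ i ≡ suc (m ∸ suc i)
      ∸-suc′ {i = i} i<m = +-∸-assoc 1 i<m

    link : ∀ {f g : Fin K} → g ≡ next f → MAdj (inj₂ f) (inj₂ g)
    link {f} refl = e≢next 2≤K f , next f , inj₂ refl , inj₁ refl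

    link′ : ∀ {f g : Fin K} → g ≡ next f → MAdj (inj₂ g) (inj₂ f)
    link′ {f} refl = (λ eq → e≢next 2≤K f (sym eq)) , next f , inj₁ refl , inj₂ refl

    l0≡r0 : l 0 ≡ r 0
    l0≡r0 = cong inj₂ (trans rot-period (sym rot-zero))

    rr : ∀ i → MAdj (r (suc i)) (r i)
    rr i = link′ (sym (next-rot i))

    wr : ∀ i → MAdj (w i) (r i)
    wr i = inj₂ (sym (next-rot i))

    ll : ∀ {i} → i < K → MAdj (l (suc i)) (l i)
    ll i<K = link (next-back i<K)

    n′<K : n′ < K
    n′<K = <-trans (n<1+n n′) n<K

    top-l : MAdj (r n) (l n′)
    top-l = subst (λ i → MAdj (inj₂ (rot i)) (l n′)) K∸n≡n (ll n′<K)

    far-top : MAdj (w′ n′) (r n)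
    far-top = subst (λ i → MAdj (w′ n′) (inj₂ (rot i))) K∸n≡n (inj₂ (next-back n′<K))

    module _ (d : Distribution (MiddleCycle k)) where

      module R = Arm r w (d (r 0)) d
      -- `l 0` is `r 0`, whose pebbles the right arm already counts; hence the base value 0.
      module L = Arm l w′ 0 d

      cover : List (V (MiddleCycle k))
      cover = r 0 ∷ r n ∷ w n′ ∷ w′ n′ ∷ R.arm n′ ++ L.arm n′

      around : ∀ {i} → n < i → i < K → ∃[ j ] 0 < j × j ≤ n′ × K ∸ j ≡ i
      around {i} n<i i<K = K ∸ i , m<n⇒0<n∸m i<K
        , s≤s⁻¹ (≤-trans (∸-monoʳ-< n<i (<⇒≤ i<K)) (≤-reflexive K∸n≡n))
        , m∸[m∸n]≡n (<⇒≤ i<K)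

      ∈-tail : ∀ {x} → x ∈ R.arm n′ ++ L.arm n′ → x ∈ cover
      ∈-tail x∈ = there (there (there (there x∈)))

      covers : ∀ x → x ∈ cover
      covers (inj₁ x) with rot-surjective x
      -- The original with index 0 is `w′ 0`, as `rot K` and `rot 0` agree. It lies on the left arm
      -- unless n′ = 0, when it is itself a neighbour of the top.
      covers (inj₁ x) | zero , _ , refl with m≤n⇒m<n∨m≡n (z≤n {n′})
      ... | inj₁ 0<n′ = ∈-tail (∈-++⁺ʳ (R.arm n′) (subst (_∈ L.arm n′)
              (cong inj₁ (trans rot-period (sym rot-zero))) (L.w∈arm n′ 0<n′)))
      ... | inj₂ 0≡n′ = there (there (there (here (cong inj₁
              (trans rot-zero (trans (sym rot-period) (cong (λ i → rot (K ∸ i)) 0≡n′)))))))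
      covers (inj₁ x) | suc i , i<K , refl with suc i ≤? n
      ... | no i≰n with around (≰⇒> i≰n) i<K
      ...   | j , _ , j≤n′ , eq with m≤n⇒m<n∨m≡n j≤n′
      ...     | inj₁ j<n′ = ∈-tail (∈-++⁺ʳ (R.arm n′) (subst (_∈ L.arm n′) (cong (λ i → inj₁ (rot i)) eq) (L.w∈arm n′ j<n′)))
      ...     | inj₂ refl = there (there (there (here (cong (λ i → inj₁ (rot i)) (sym eq)))))
      covers (inj₁ x) | suc i , i<K , refl | yes i≤n with m≤n⇒m<n∨m≡n (s≤s⁻¹ i≤n)
      ... | inj₁ i<n′ = ∈-tail (∈-++⁺ˡ (R.w∈arm n′ i<n′))
      ... | inj₂ refl = there (there (here refl))
      covers (inj₂ x) with rot-surjective x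
      covers (inj₂ x) | zero , _ , refl = here refl
      covers (inj₂ x) | suc i , i<K , refl with suc i ≤? n
      ... | no i≰n with around (≰⇒> i≰n) i<K
      ...   | j , 0<j , j≤n′ , eq = ∈-tail (∈-++⁺ʳ (R.arm n′)
                (subst (_∈ L.arm n′) (cong (λ i → inj₂ (rot i)) eq) (L.r∈arm n′ 0<j j≤n′)))
      covers (inj₂ x) | suc i , i<K , refl | yes i≤n with m≤n⇒m<n∨m≡n i≤n
      ... | inj₁ i<n = ∈-tail (∈-++⁺ˡ (R.r∈arm n′ (s≤s z≤n) (s≤s⁻¹ i<n)))
      ... | inj₂ refl = there (here refl)

      length-cover : length cover ≡ length (vertices (MiddleCycle k))
      length-cover = begin
        4 + length (R.arm n′ ++ L.arm n′)           ≡⟨ cong (4 +_) (length-++ (R.arm n′)) ⟩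
        4 + (length (R.arm n′) + length (L.arm n′)) ≡⟨ cong (4 +_) (cong₂ _+_ (R.length-arm n′) (L.length-arm n′)) ⟩
        4 + (2 * n′ + 2 * n′)                       ≡⟨ lemma n′ ⟩
        2 * (2 * suc n′)                            ≡⟨ cong (2 *_) (sym K≡2n) ⟩
        2 * K                                       ≡⟨ length-MiddleCycle k ⟨
        length (vertices (MiddleCycle k))           ∎
        where
        open ≡-Reasoning
        lemma : ∀ n′ → 4 + (2 * n′ + 2 * n′) ≡ 2 * (2 * suc n′)
        lemma = solve-∀

      vertices↭cover : vertices (MiddleCycle k) ↭ cover
      vertices↭cover = unique-covered⇒↭ (unique (MiddleCycle k)) (λ {x} _ → covers x) (≤-reflexive length-cover)

      sum-cover : ∀ (f : V (MiddleCycle k) → ℕ) → sum (map f cover) ≡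
        f (r 0) + (f (r n) + (f (w n′) + (f (w′ n′) + (sum (map f (R.arm n′)) + sum (map f (L.arm n′))))))
      sum-cover f = cong (λ a → f (r 0) + (f (r n) + (f (w n′) + (f (w′ n′) + a))))
        (trans (cong sum (map-++ f (R.arm n′) (L.arm n′))) (sum-++ (map f (R.arm n′)) (map f (L.arm n′))))

      fork : ∀ {x y z} a b {N} → MAdj x y → MAdj x z → 2 * (a + b) ≤ N →
        point x N ⇝ point y a ⊕ point z b
      fork {x} {y} {z} a b {N} xy xz le = ⇝-trans
        (discard {d′ = point x (2 * a) ⊕ point x (2 * b)} λ v →
          ≤-trans (≤-reflexive (sym (point-+ x (2 * a) (2 * b) v)))
            (point-mono x (≤-trans (≤-reflexive (sym (*-distribˡ-+ 2 a b))) le) v))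
        (⇝-⊕ (push xy (MAdj⇒≢ xy) a ≤-refl) (push xz (MAdj⇒≢ xz) b ≤-refl))

      s t T : ℕ
      s = d (w n′) / 2
      t = d (w′ n′) / 2
      T = d (r n)

      -- Odd pebbles: n′ on each arm and one on each neighbour of the top, 2n together. Rounding 2ⁿ
      -- / 3 down costs at most 2 after multiplication by 3, which the `+ 3` in `Enough` absorbs.
      enough : ∀ m → m * 2 ^ n + (2 * n + 2 ^ n / 3) ≤ size (MiddleCycle k) d →
        Enough M m (R.worth n′) (L.worth n′) s t T
      enough m le = ≤-from _ _ 1
        (+-mono-≤ (*-monoʳ-≤ 3 (≤-trans le (≤-reflexive size≡)))
          (+-mono-≤ (*-monoʳ-≤ 3 (+-mono-≤ (+-mono-≤ (R.arm-size n′) (L.arm-size n′))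
                                   (+-mono-≤ (n≤1+2*[n/2] (d (w n′))) (n≤1+2*[n/2] (d (w′ n′))))))
                    2M≤))
        (lemma M m n′ (2 ^ n / 3) (d (r 0)) T (d (w n′)) (d (w′ n′)) (sum (map d (R.arm n′))) (sum (map d (L.arm n′)))
          (R.worth n′) (L.worth n′) s t)
        where
        size≡ = trans (sum-↭ (map⁺ d vertices↭cover)) (sum-cover d)
        2M≤ : 2 * M ≤ 3 * (2 ^ n / 3) + 2
        2M≤ = ≤-trans (≤-reflexive (m≡m%n+[m/n]*n (2 ^ n) 3))
          (≤-trans (+-monoˡ-≤ _ (s≤s⁻¹ (m%n<n (2 ^ n) 3)))
            (≤-reflexive (trans (+-comm 2 _) (cong (_+ 2) (*-comm (2 ^ n / 3) 3)))))
        lemma : ∀ M m n′ q β T x y SR SL A B s t →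
          6 * M * m + 2 * M
            + (3 * (β + (T + (x + (y + (SR + SL))))) + (3 * (A + n′ + (B + n′) + (suc (2 * s) + suc (2 * t))) + (3 * q + 2))) + 1
          ≡ 3 * (A + B + 2 * s + 2 * t + T) + 3
            + (3 * (m * (2 * M) + (2 * suc n′ + q)) + (3 * (β + SR + (0 + SL) + (x + y)) + 2 * M))
        lemma = solve-∀

      -- The neighbours of the top move before the top does, since the top also passes on what it
      -- receives from them; the arms are collected last.
      deliver : ∀ {m} → Routing M m (R.worth n′) (L.worth n′) s t T → d ⇝ point (r 0) m
      deliver {m} (routing s₁ s₂ t₁ t₂ z₁ z₂ kᵣ kₗ s≤ t≤ top≤ right≤ left≤ total) =
        ⇝-trans (discard (⨁-points d vertices↭cover))
        (⇝-trans (discard {d′ = arms ⊕ (point (r n) T ⊕ point (w n′) (d (w n′)) ⊕ point (w′ n′) (d (w′ n′)))} λ z →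
          ≤-reflexive (trans (lemma₁ (f (r 0) z) (f (r n) z) (f (w n′) z) (f (w′ n′) z) (R.load n′ z) (L.load n′ z) (point (l 0) 0 z) (zero-l z))
            (sym (sum-cover (λ x → f x z)))))
        (⇝-trans (⇝-⊕ {d₁ = arms} (discard λ _ → ≤-refl)
          (⇝-⊕ (⇝-⊕ (discard {d′ = point (r n) T} λ _ → ≤-refl)
            (fork s₁ s₂ (wr n′) (inj₁ refl) (≤-trans (*-monoʳ-≤ 2 s≤) (2*[n/2]≤n _))))
            (fork t₁ t₂ (inj₁ refl) far-top (≤-trans (*-monoʳ-≤ 2 t≤) (2*[n/2]≤n _)))))
        (⇝-trans (discard {d′ = arms ⊕ (point (r n′) s₁ ⊕ point (l n′) t₁) ⊕ point (r n) (s₂ + t₂ + T)} λ z → 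
          ≤-reflexive (trans (cong (arms z + (point (r n′) s₁ z + point (l n′) t₁ z) +_)
              (trans (point-+ (r n) (s₂ + t₂) T z) (cong (_+ point (r n) T z) (point-+ (r n) s₂ t₂ z))))
            (lemma₂ (arms z) (point (r n′) s₁ z) (point (l n′) t₁ z) (point (r n) s₂ z) (point (r n) t₂ z) (point (r n) T z))))
        (⇝-trans (⇝-⊕ {d₁ = arms ⊕ (point (r n′) s₁ ⊕ point (l n′) t₁)} (discard λ _ → ≤-refl)
          (fork z₁ z₂ (rr n′) top-l top≤))
        (⇝-trans (discard {d′ = (point (r 0) (d (r 0)) ⊕ R.load n′ ⊕ point (r n′) (s₁ + z₁)) ⊕ (point (l 0) 0 ⊕ L.load n′ ⊕ point (l n′) (t₁ + z₂))} λ z →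
          ≤-reflexive (trans (cong₂ _+_ (cong (f (r 0) z + R.load n′ z +_) (point-+ (r n′) s₁ z₁ z))
                                        (cong (point (l 0) 0 z + L.load n′ z +_) (point-+ (l n′) t₁ z₂ z)))
            (lemma₃ (f (r 0) z) (R.load n′ z) (point (l 0) 0 z) (L.load n′ z) (point (r n′) s₁ z) (point (l n′) t₁ z) (point (r n′) z₁ z) (point (l n′) z₂ z))))
        (⇝-trans (⇝-⊕ (R.collect n′ (λ i _ → rr i) (λ i _ → wr i) (s₁ + z₁) kᵣ right≤)
                       (L.collect n′ (λ i i<n′ → ll (<-trans i<n′ n′<K)) (λ _ _ → inj₁ refl) (t₁ + z₂) kₗ left≤))
        (discard λ z → ≤-trans (point-mono (r 0) total z)
          (≤-reflexive (trans (point-+ (r 0) kᵣ kₗ z) (cong (λ x → point (r 0) kᵣ z + point x kₗ z) (sym l0≡r0)))))))))))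
        where
        f : V (MiddleCycle k) → Distribution (MiddleCycle k)
        f x = point x (d x)
        arms : Distribution (MiddleCycle k)
        arms = (f (r 0) ⊕ R.load n′) ⊕ (point (l 0) 0 ⊕ L.load n′)
        zero-l : ∀ z → point (l 0) 0 z ≡ 0
        zero-l z = n≤0⇒n≡0 (point-≼ {d = λ _ → 0} z≤n z)
        lemma₁ : ∀ a b x y R L o → o ≡ 0 → a + R + (o + L) + (b + x + y) ≡ a + (b + (x + (y + (R + L))))
        lemma₁ a b x y R L .0 refl = lemma a b x y R L
          where
          lemma : ∀ a b x y R L → a + R + L + (b + x + y) ≡ a + (b + (x + (y + (R + L))))
          lemma = solve-∀
        lemma₂ : ∀ a x y s t T → a + (x + y) + (s + t + T) ≡ a + (T + (x + s) + (y + t))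
        lemma₂ = solve-∀
        lemma₃ : ∀ a R o L x y u v → a + R + (x + u) + (o + L + (y + v)) ≡ a + R + (o + L) + (x + y) + (u + v)
        lemma₃ = solve-∀

  reach-inserted : ∀ m d → m * 2 ^ n + (2 * n + 2 ^ n / 3) ≤ size (MiddleCycle k) d →
    d ⇝ point (inj₂ e) m
  reach-inserted m d le = subst (λ x → d ⇝ point (inj₂ x) m) rot-zero
    (deliver d (route M m (R.worth d n′) (L.worth d n′) (s d) (t d) (T d) (enough d m le)))

-- The lower bound for M(C₂ₙ)

-- With H i the distance of the original vertex i from its antipode n, weights
-- 2 ^ H on original and 2 ^ min on inserted vertices make the weighted number
-- of pebbles non-increasing.  Away from the target 0, an original vertex is
-- only worth its number of pebble pairs: a lone pebble there cannot move.
module LowerBound {k n} (K≡2n : suc k ≡ 2 * n) (0<n : 0 < n) where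

  private
    G : Graph
    G = MiddleCycle k
    K : ℕ
    K = suc k

  open Reach G
  open Points _≟ᴹ_

  H : Fin K → ℕ
  H i = ∣ toℕ i - n ∣

  h : Fin K → ℕ
  h e = H e ⊓ H (next e)

  ∣2n-n∣≡n : ∣ K - n ∣ ≡ n
  ∣2n-n∣≡n = trans (cong (λ a → ∣ a - n ∣) (trans K≡2n (cong (n +_) (+-identityʳ n))))
    (trans (∣-∣-comm (n + n) n) (∣m-m+n∣≡n n n))

  -- Since the cycle has length 2n, 0 and 2n are equally far from n, so the formula survives the
  -- wrap-around.
  H-next : ∀ e → H (next e) ≡ ∣ suc (toℕ e) - n ∣
  H-next e with m≤n⇒m<n∨m≡n (Fin.toℕ<n e)
  ... | inj₁ e+1<K = cong (λ a → ∣ a - n ∣) (trans (toℕ-next e) (m<n⇒m%n≡m e+1<K))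
  ... | inj₂ e+1≡K = begin
    ∣ toℕ (next e) - n ∣        ≡⟨ cong (λ a → ∣ a - n ∣) (trans (toℕ-next e) (trans (cong (_% K) e+1≡K) (n%n≡0 K))) ⟩
    n                           ≡⟨ ∣2n-n∣≡n ⟨
    ∣ K - n ∣                   ≡⟨ cong (λ a → ∣ a - n ∣) e+1≡K ⟨
    ∣ suc (toℕ e) - n ∣         ∎
    where open ≡-Reasoning

  ∣1+a-a∣≡1 : ∀ a → ∣ suc a - a ∣ ≡ 1
  ∣1+a-a∣≡1 zero    = refl
  ∣1+a-a∣≡1 (suc a) = ∣1+a-a∣≡1 a

  H≤1+H-next : ∀ e → H e ≤ suc (H (next e))
  H≤1+H-next e = subst (λ x → H e ≤ suc x) (sym (H-next e)) (begin
    ∣ a - n ∣                     ≤⟨ ∣-∣-triangle a (suc a) n ⟩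
    ∣ a - suc a ∣ + ∣ suc a - n ∣ ≡⟨ cong (_+ ∣ suc a - n ∣) (trans (∣-∣-comm a (suc a)) (∣1+a-a∣≡1 a)) ⟩
    suc ∣ suc a - n ∣             ∎)
    where
    open ≤-Reasoning
    a = toℕ e

  H-next≤1+H : ∀ e → H (next e) ≤ suc (H e)
  H-next≤1+H e = subst (_≤ suc (H e)) (sym (H-next e)) (begin
    ∣ suc a - n ∣                 ≤⟨ ∣-∣-triangle (suc a) a n ⟩
    ∣ suc a - a ∣ + ∣ a - n ∣     ≡⟨ cong (_+ ∣ a - n ∣) (∣1+a-a∣≡1 a) ⟩
    suc ∣ a - n ∣                 ∎)
    where
    open ≤-Reasoning
    a = toℕ e

  h≤H : ∀ {i e} → IsEndpoint i e → h e ≤ H i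
  h≤H {e = e} (inj₁ refl) = m⊓n≤m (H e) (H (next e))
  h≤H {e = e} (inj₂ refl) = m⊓n≤n (H e) (H (next e))

  H≤1+h : ∀ {i e} → IsEndpoint i e → H i ≤ suc (h e)
  H≤1+h {e = e} (inj₁ refl) = ⊓-glb (n≤1+n _) (H≤1+H-next e)
  H≤1+h {e = e} (inj₂ refl) = ⊓-glb (H-next≤1+H e) (n≤1+n _)

  -- Exponents bounding the value that one arriving pebble can add and the value that two departing
  -- pebbles must remove. At an original both are one pair's worth; at an inserted vertex two
  -- departing pebbles are worth twice one.
  gain loss : V G → ℕ
  gain (inj₁ i) = H i
  gain (inj₂ e) = h e
  loss (inj₁ i) = H i
  loss (inj₂ e) = suc (h e)

  gain≤loss : ∀ {x y} → Adj G x y → gain y ≤ loss x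
  gain≤loss {inj₁ i} {inj₂ e} i∈e                 = h≤H i∈e
  gain≤loss {inj₂ e} {inj₁ i} i∈e                 = H≤1+h i∈e
  gain≤loss {inj₂ e} {inj₂ f} (_ , i , i∈e , i∈f) = ≤-trans (h≤H i∈f) (H≤1+h i∈e)

  value : V G → ℕ → ℕ
  value (inj₁ zero)    t = 2 ^ n * t
  value (inj₁ (suc i)) t = 2 ^ H (suc i) * ⌊ t /2⌋
  value (inj₂ e)       t = 2 ^ h e * t

  value-gain : ∀ x t → value x (t + 1) ≤ value x t + 2 ^ gain x
  value-gain (inj₁ zero) t = ≤-reflexive (lemma (2 ^ n) t)
    where
    lemma : ∀ a t → a * (t + 1) ≡ a * t + a
    lemma = solve-∀
  value-gain (inj₁ (suc i)) t = ≤-trans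
    (*-monoʳ-≤ (2 ^ H (suc i)) (≤-trans (≤-reflexive (cong ⌊_/2⌋ (+-comm t 1))) (⌊n/2⌋-mono (n≤1+n (suc t)))))
    (≤-reflexive (trans (*-suc (2 ^ H (suc i)) ⌊ t /2⌋) (+-comm (2 ^ H (suc i)) _)))
  value-gain (inj₂ e) t = ≤-reflexive (lemma (2 ^ h e) t)
    where
    lemma : ∀ a t → a * (t + 1) ≡ a * t + a
    lemma = solve-∀

  value-loss : ∀ x t → value x t + 2 ^ loss x ≤ value x (t + 2)
  value-loss (inj₁ zero) t = ≤-from _ _ (2 ^ n) ≤-refl (lemma (2 ^ n) t)
    where
    lemma : ∀ a t → a * t + a + 0 + a ≡ a * (t + 2) + 0
    lemma = solve-∀
  value-loss (inj₁ (suc i)) t = ≤-reflexive (begin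
    W * ⌊ t /2⌋ + W   ≡⟨ trans (+-comm _ W) (sym (*-suc W ⌊ t /2⌋)) ⟩
    W * ⌊ 2 + t /2⌋   ≡⟨ cong (λ a → W * ⌊ a /2⌋) (+-comm 2 t) ⟩
    W * ⌊ t + 2 /2⌋   ∎)
    where
    open ≡-Reasoning
    W = 2 ^ H (suc i)
  value-loss (inj₂ e) t = ≤-reflexive (lemma (2 ^ h e) t)
    where
    lemma : ∀ a t → a * t + 2 * a ≡ a * (t + 2)
    lemma = solve-∀

  potential : Distribution G → ℕ
  potential d = size G (λ z → value z (d z))

  Move⇒potential≤ : ∀ {d d′} → Move G d d′ → potential d′ ≤ potential d
  Move⇒potential≤ {d} {d′} (x , y , adj , _ , eqx , eqy , eqz) =
    ≤-from _ _ 0 local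
      (trans (+-identityʳ _) (trans (sym (size₃ f′ f)) (trans (sum-map-cong pointwise (vertices G)) (size₃ f f′))))
    where
    f f′ : Distribution G
    f z  = value z (d z)
    f′ z = value z (d′ z)
    x≢y : x ≢ y
    x≢y = MAdj⇒≢ adj
    local : f′ x + f′ y ≤ f x + f y
    local = begin
      value x (d′ x) + value y (d′ y)         ≡⟨ cong (λ t → value x (d′ x) + value y t) eqy ⟩
      value x (d′ x) + value y (d y + 1)      ≤⟨ +-monoʳ-≤ (value x (d′ x)) (value-gain y (d y)) ⟩
      value x (d′ x) + (f y + 2 ^ gain y)     ≤⟨ +-monoʳ-≤ (value x (d′ x)) (+-monoʳ-≤ (f y) (^-monoʳ-≤ 2 (gain≤loss adj))) ⟩
      value x (d′ x) + (f y + 2 ^ loss x)     ≡⟨ lemma (value x (d′ x)) (f y) (2 ^ loss x) ⟩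
      value x (d′ x) + 2 ^ loss x + f y       ≤⟨ +-monoˡ-≤ (f y) (value-loss x (d′ x)) ⟩
      value x (d′ x + 2) + f y                ≡⟨ cong (λ t → value x t + f y) eqx ⟩
      f x + f y                               ∎
      where
      open ≤-Reasoning
      lemma : ∀ a b c → a + (b + c) ≡ a + c + b
      lemma = solve-∀
    size₃ : ∀ (g g′ : Distribution G) → size G (g ⊕ (point x (g′ x) ⊕ point y (g′ y))) ≡ size G g + (g′ x + g′ y)
    size₃ g g′ = trans (size-⊕ g (point x (g′ x) ⊕ point y (g′ y))) (cong (size G g +_)
      (trans (size-⊕ (point x (g′ x)) (point y (g′ y))) (cong₂ _+_ (size-point x (g′ x)) (size-point y (g′ y)))))
    -- Each side carries the other's values at `x` and `y`, so the sums can be compared without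
    -- subtraction.
    pointwise : ∀ z → f′ z + (point x (f x) z + point y (f y) z)
                    ≡ f z + (point x (f′ x) z + point y (f′ y) z)
    pointwise z with z ≟ᴹ x | z ≟ᴹ y
    ... | yes refl | yes refl = contradiction refl x≢y
    ... | yes refl | no _     = lemma (f′ x) (f x)
      where
      lemma : ∀ a b → a + (b + 0) ≡ b + (a + 0)
      lemma = solve-∀
    ... | no _     | yes refl = +-comm (f′ y) (f y)
    ... | no z≢x   | no z≢y   = cong (λ t → value z t + 0) (eqz z z≢x z≢y)

  potential-≤ : ∀ {d d′} → G ⊢ d ⇒* d′ → potential d′ ≤ potential d
  potential-≤ ε        = ≤-refl
  potential-≤ (m ◅ ms) = ≤-trans (potential-≤ ms) (Move⇒potential≤ m)

  target : V G
  target = inj₁ zero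

  n<K : n < K
  n<K = subst (n <_) (sym K≡2n) (≤-trans (+-monoˡ-≤ n 0<n) (≤-reflexive (cong (n +_) (sym (+-identityʳ n)))))

  antipode : Fin K
  antipode = fromℕ< n<K

  original : Distribution G
  original (inj₁ _) = 1
  original (inj₂ _) = 0

  size-original : size G original ≡ K
  size-original = begin
    sum (map original (map inj₁ is ++ map inj₂ is))
      ≡⟨ cong sum (map-++ original (map inj₁ is) (map inj₂ is)) ⟩
    sum (map original (map inj₁ is) ++ map original (map inj₂ is))
      ≡⟨ sum-++ (map original (map inj₁ is)) (map original (map inj₂ is)) ⟩
    sum (map original (map inj₁ is)) + sum (map original (map inj₂ is))
      ≡⟨ cong₂ (λ a b → sum a + sum b) (map-∘ {g = original} {f = inj₁} is) (map-∘ {g = original} {f = inj₂} is) ⟨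
    sum (map (λ _ → 1) is) + sum (map (λ _ → 0) is)
      ≡⟨ cong₂ _+_ (sum-map-const 1 is) (sum-map-const 0 is) ⟩
    length is * 1 + length is * 0
      ≡⟨ cong₂ _+_ (*-identityʳ (length is)) (*-zeroʳ (length is)) ⟩
    length is + 0
      ≡⟨ trans (+-identityʳ (length is)) (length-tabulate {n = K} (λ i → i)) ⟩
    K ∎
    where
    open ≡-Reasoning
    is = allFin K

  P : ℕ
  P = 2 ^ n ∸ 1

  1+P≡2^n : suc P ≡ 2 ^ n
  1+P≡2^n = m+[n∸m]≡n (m^n>0 2 n)

  others : Σ (Distribution G) λ d₀ → ∀ z → original z ≡ d₀ z + point target 1 z
  others = remove target 1 original ≤-refl

  -- The antipode holds 2P + 1 pebbles, that is P pairs, and the lone pebbles elsewhere have no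
  -- value. The potential is therefore at most P = 2ⁿ - 1, one short of a pebble on the target.
  stuck : Distribution G
  stuck = proj₁ others ⊕ point (inj₁ antipode) (2 * P)

  size-stuck : suc (size G stuck) ≡ K + 2 * P
  size-stuck = begin
    suc (size G stuck)                  ≡⟨ cong suc (trans (size-⊕ d₀ _) (cong (size G d₀ +_) (size-point (inj₁ antipode) (2 * P)))) ⟩
    suc (size G d₀ + 2 * P)             ≡⟨ cong (_+ 2 * P) (+-comm 1 (size G d₀)) ⟩
    size G d₀ + 1 + 2 * P               ≡⟨ cong (λ a → size G d₀ + a + 2 * P) (size-point target 1) ⟨
    size G d₀ + size G (point target 1) + 2 * P ≡⟨ cong (_+ 2 * P) (size-⊕ d₀ (point target 1)) ⟨
    size G (d₀ ⊕ point target 1) + 2 * P ≡⟨ cong (_+ 2 * P) (sum-map-cong (proj₂ others) (vertices G)) ⟨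
    size G original + 2 * P             ≡⟨ cong (_+ 2 * P) size-original ⟩
    K + 2 * P                           ∎
    where
    open ≡-Reasoning
    d₀ = proj₁ others

  others≤original : ∀ z → proj₁ others z ≤ original z
  others≤original z = ≤-trans (m≤m+n _ _) (≤-reflexive (sym (proj₂ others z)))

  value-stuck : ∀ z → value z (stuck z) ≤ point (inj₁ antipode) P z
  value-stuck (inj₂ e) = ≤-trans (≤-reflexive (trans
    (cong (2 ^ h e *_) (cong₂ _+_ (n≤0⇒n≡0 (others≤original (inj₂ e))) (point-off {inj₁ antipode} {inj₂ e} (2 * P) λ ())))
    (*-zeroʳ (2 ^ h e)))) z≤n
  value-stuck (inj₁ zero) = ≤-trans (≤-reflexive (trans
    (cong (2 ^ n *_) (cong₂ _+_ (+-cancelʳ-≡ 1 _ 0 (sym (proj₂ others target))) (point-off (2 * P) 0≢antipode)))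
    (*-zeroʳ (2 ^ n)))) z≤n
    where
    0≢antipode : inj₁ zero ≢ inj₁ antipode
    0≢antipode eq = contradiction (trans (cong toℕ (Sum.inj₁-injective eq)) (Fin.toℕ-fromℕ< n<K)) (<⇒≢ 0<n)
  value-stuck (inj₁ (suc i)) with inj₁ (suc i) ≟ᴹ inj₁ antipode
  ... | no _  = ≤-reflexive (trans (cong (2 ^ H (suc i) *_) (n≤0⇒n≡0 (⌊n/2⌋-mono {y = 1}
    (≤-trans (≤-reflexive (+-identityʳ _)) (others≤original (inj₁ (suc i))))))) (*-zeroʳ (2 ^ H (suc i))))
  ... | yes eq = begin
    2 ^ H (suc i) * ⌊ proj₁ others (inj₁ (suc i)) + 2 * P /2⌋
      ≡⟨ cong (λ a → 2 ^ a * ⌊ proj₁ others (inj₁ (suc i)) + 2 * P /2⌋) H≡0 ⟩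
    1 * ⌊ proj₁ others (inj₁ (suc i)) + 2 * P /2⌋
      ≡⟨ *-identityˡ _ ⟩
    ⌊ proj₁ others (inj₁ (suc i)) + 2 * P /2⌋
      ≤⟨ ⌊n/2⌋-mono (+-monoˡ-≤ (2 * P) (others≤original (inj₁ (suc i)))) ⟩
    ⌊ suc (2 * P) /2⌋
      ≡⟨ ⌊1+2p/2⌋≡p P ⟩
    P ∎
    where
    open ≤-Reasoning
    H≡0 : H (suc i) ≡ 0
    H≡0 = trans (cong H (Sum.inj₁-injective eq)) (m≡n⇒∣m-n∣≡0 (Fin.toℕ-fromℕ< n<K))
    ⌊1+2p/2⌋≡p : ∀ p → ⌊ suc (2 * p) /2⌋ ≡ p
    ⌊1+2p/2⌋≡p zero    = refl
    ⌊1+2p/2⌋≡p (suc p) = trans (cong (λ a → ⌊ suc a /2⌋) (*-suc 2 p)) (cong suc (⌊1+2p/2⌋≡p p))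

  stuck-unsolvable : ¬ (stuck ⇝ point target 1)
  stuck-unsolvable (e , run , le) = n≮n P (begin-strict
    P                      <⟨ ≤-reflexive 1+P≡2^n ⟩
    2 ^ n                  ≡⟨ *-identityʳ (2 ^ n) ⟨
    2 ^ n * 1              ≤⟨ *-monoʳ-≤ (2 ^ n) (subst (_≤ e target) (point-at target 1) (le target)) ⟩
    value target (e target) ≤⟨ ≤-sum-map (λ z → value z (e z)) (complete G target) ⟩
    potential e            ≤⟨ potential-≤ run ⟩
    potential stuck        ≤⟨ sum-map-mono value-stuck (vertices G) ⟩
    size G (point (inj₁ antipode) P) ≡⟨ size-point (inj₁ antipode) P ⟩
    P                      ∎)
    where open ≤-Reasoning

  pebbling-number-≥ : ∀ {b} → IsPebblingNumber G b → 2 * 2 ^ n + 2 * n ≤ b + 2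
  pebbling-number-≥ {b} (bound , _) with bound target
  ... | N , (solvable , _) , N≤b = begin
    2 * 2 ^ n + 2 * n    ≡⟨ cong₂ (λ p q → 2 * p + q) 1+P≡2^n K≡2n ⟨
    2 * suc P + K        ≡⟨ lemma P K ⟩
    K + 2 * P + 2        ≡⟨ cong (_+ 2) size-stuck ⟨
    suc (size G stuck) + 2 ≤⟨ +-monoˡ-≤ 2 (≰⇒> λ N≤size → stuck-unsolvable (AllSolvable⇒⇝ solvable stuck N≤size)) ⟩
    N + 2                ≤⟨ +-monoˡ-≤ 2 N≤b ⟩
    b + 2                ∎
    where
    open ≤-Reasoning
    lemma : ∀ P K → 2 * suc P + K ≡ K + 2 * P + 2
    lemma = solve-∀

-- Pebbling along a graph embedding

module Embedding (G P : Graph) (_≟ᴳ_ : DecidableEquality (V G)) (_≟ᴾ_ : DecidableEquality (V P))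
  (ι : V G → V P) (ι-injective : ∀ {x y} → ι x ≡ ι y → x ≡ y)
  (ι-adj : ∀ {x y} → Adj G x y → Adj P (ι x) (ι y)) where

  private
    module RG = Reach G
    module PG = RG.Points _≟ᴳ_
  open Reach P
  open Points _≟ᴾ_

  -- As a sum of heaps it needs no test for membership in the image of `ι`, and it matches the
  -- splitting of a distribution into heaps.
  embed : Distribution G → Distribution P
  embed d = ⨁ (vertices G) (λ x → point (ι x) (d x))

  embed-mono : ∀ {d d′} → d RG.≼ d′ → embed d ≼ embed d′
  embed-mono d≼d′ z = sum-map-mono (λ x → point-mono (ι x) (d≼d′ x) z) (vertices G)

  embed-⊕ : ∀ d d′ z → embed (d RG.⊕ d′) z ≡ embed d z + embed d′ z
  embed-⊕ d d′ z = trans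
    (sum-map-cong (λ x → point-+ (ι x) (d x) (d′ x) z) (vertices G))
    (sum-map-+ (λ x → point (ι x) (d x) z) (λ x → point (ι x) (d′ x) z) (vertices G))

  embed-point : ∀ x k z → embed (PG.point x k) z ≡ point (ι x) k z
  embed-point x k z = trans
    (sum-map-supported (λ y → point (ι y) (PG.point x k y) z) (unique G) (complete G x)
      (λ y y≢x → trans (cong (λ a → point (ι y) a z) (PG.point-off k y≢x))
                       (n≤0⇒n≡0 (point-≼ {d = λ _ → 0} z≤n z))))
    (cong (λ a → point (ι x) a z) (PG.point-at x k))

  embed-Move : ∀ {d d′} → Move G d d′ → embed d ⇝ embed d′
  embed-Move {d} {d′} (x , y , adj , 2≤dx , eqx , eqy , eqz) with PG.remove x 2 d 2≤dx
  ... | d₀ , split = ⇝-trans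
    (discard {d′ = embed d₀ ⊕ point (ι x) 2} λ z → ≤-trans
      (≤-reflexive (sym (trans (embed-⊕ d₀ (PG.point x 2) z) (cong (embed d₀ z +_) (embed-point x 2 z)))))
      (embed-mono (λ w → ≤-reflexive (sym (split w))) z))
    (⇝-trans
      (⇝-⊕ {d₁ = embed d₀} (discard λ _ → ≤-refl) (move-point (ι-adj adj) (λ eq → x≢y (ι-injective eq))))
      (discard λ z → ≤-trans
        (embed-mono (λ w → ≤-reflexive (split′ w)) z)
        (≤-reflexive (trans (embed-⊕ d₀ (PG.point y 1) z) (cong (embed d₀ z +_) (embed-point y 1 z))))))
    where
    -- A `Graph` may have loops, but the two equations for the source and the destination of a move
    -- contradict each other if these coincide.
    x≢y : x ≢ y
    x≢y refl = <⇒≢ (≤-trans (≤-reflexive (+-comm 1 (d x))) (≤-trans (≤-reflexive (sym eqy)) (m≤m+n (d′ x) 2))) (sym eqx)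
    split′ : ∀ w → d′ w ≡ d₀ w + PG.point y 1 w
    split′ w with w ≟ᴳ x | w ≟ᴳ y | split w
    ... | yes refl | yes refl | _  = contradiction refl x≢y
    ... | yes refl | no _     | sp = trans (+-cancelʳ-≡ 2 _ _ (trans eqx sp)) (sym (+-identityʳ (d₀ x)))
    ... | no _     | yes refl | sp = trans eqy (cong (_+ 1) (trans sp (+-identityʳ (d₀ y))))
    ... | no w≢x   | no w≢y   | sp = trans (eqz w w≢x w≢y) sp

  embed-⇝ : ∀ {d d′} → d RG.⇝ d′ → embed d ⇝ embed d′
  embed-⇝ (e , run , le) = ⇝-trans (embed-⇒* run) (discard (embed-mono le))
    where
    embed-⇒* : ∀ {d d′} → G ⊢ d ⇒* d′ → embed d ⇝ embed d′
    embed-⇒* ε        = discard λ _ → ≤-refl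
    embed-⇒* (m ◅ ms) = ⇝-trans (embed-Move m) (embed-⇒* ms)

-- Products

sum-map-cartesianProduct : ∀ {A B : Set} (f : A × B → ℕ) xs ys →
  sum (map f (cartesianProduct xs ys)) ≡ sum (map (λ x → sum (map (λ y → f (x , y)) ys)) xs)
sum-map-cartesianProduct f []       ys = refl
sum-map-cartesianProduct f (x ∷ xs) ys = begin
  sum (map f (map (x ,_) ys ++ cartesianProduct xs ys))
    ≡⟨ cong sum (map-++ f (map (x ,_) ys) (cartesianProduct xs ys)) ⟩
  sum (map f (map (x ,_) ys) ++ map f (cartesianProduct xs ys))
    ≡⟨ sum-++ (map f (map (x ,_) ys)) (map f (cartesianProduct xs ys)) ⟩
  sum (map f (map (x ,_) ys)) + sum (map f (cartesianProduct xs ys))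
    ≡⟨ cong₂ _+_ (cong sum (sym (map-∘ {g = f} {f = x ,_} ys))) (sum-map-cartesianProduct f xs ys) ⟩
  sum (map (λ y → f (x , y)) ys) + sum (map (λ x → sum (map (λ y → f (x , y)) ys)) xs) ∎
  where open ≡-Reasoning

module _ (G H : Graph) where

  fibre : Distribution (G □ H) → V H → Distribution G
  fibre D h g = D (g , h)

  fibre-size : Distribution (G □ H) → V H → ℕ
  fibre-size D h = size G (fibre D h)

  size-fibres : ∀ D → size (G □ H) D ≡ sum (map (fibre-size D) (vertices H))
  size-fibres D = trans (sum-map-cartesianProduct D (vertices G) (vertices H))
    (sum-map-exchange (λ g h → D (g , h)) (vertices G) (vertices H))

  module _ (_≟ᴳ_ : DecidableEquality (V G)) (_≟ᴴ_ : DecidableEquality (V H)) where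

    private
      _≟ᴾ_ : DecidableEquality (V (G □ H))
      _≟ᴾ_ = Product.≡-dec _≟ᴳ_ _≟ᴴ_
      module RG = Reach G
      module PG = RG.Points _≟ᴳ_
      module RH = Reach H
      module PH = RH.Points _≟ᴴ_
      module Fibre h = Embedding G (G □ H) _≟ᴳ_ _≟ᴾ_ (_, h) Product.,-injectiveˡ (λ adj → inj₂ (adj , refl))
      module Row u = Embedding H (G □ H) _≟ᴴ_ _≟ᴾ_ (u ,_) Product.,-injectiveʳ (λ adj → inj₁ (refl , adj))
    open Reach (G □ H)
    open Points _≟ᴾ_

    -- `κ` depends on the size of a fibre alone, which reduces the product to bookkeeping with the
    -- fibre sizes.
    via-row : ∀ {u v c} (κ : ℕ → ℕ) → (∀ d → d RG.⇝ PG.point u (κ (size G d))) →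
      (∀ d → c ≤ size H d → d RH.⇝ PH.point v 1) →
      ∀ D → c ≤ sum (map (λ h → κ (fibre-size D h)) (vertices H)) → D ⇝ point (u , v) 1
    via-row {u} {v} κ fibre⇝ row⇝ D c≤ =
      ⇝-trans (discard λ z → ≤-trans (≤-reflexive (sym (by-fibres z))) (⨁-points D Perm.refl z))
      (⇝-trans (⇝-⨁ (λ h → Fibre.embed-⇝ h (fibre⇝ (fibre D h))) (vertices H))
      (⇝-trans (discard λ z → sum-map-mono (λ h → ≤-reflexive (sym (Fibre.embed-point h u _ z))) (vertices H))
      (⇝-trans (Row.embed-⇝ u (row⇝ (λ h → κ (fibre-size D h)) c≤))
      (discard λ z → ≤-reflexive (sym (Row.embed-point u v 1 z))))))
      where
      by-fibres : ∀ z → ⨁ (vertices (G □ H)) (λ x → point x (D x)) z ≡ ⨁ (vertices H) (λ h → Fibre.embed h (fibre D h)) z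
      by-fibres z = trans (sum-map-cartesianProduct (λ x → point x (D x) z) (vertices G) (vertices H))
        (sum-map-exchange (λ g h → point (g , h) (D (g , h)) z) (vertices G) (vertices H))

    fibre-size-point : ∀ g h k h′ → fibre-size (point (g , h) k) h′ ≡ PH.point h k h′
    fibre-size-point g h k h′ = trans
      (sum-map-supported (fibre (point (g , h) k) h′) (unique G) (complete G g)
        (λ g′ g′≢g → point-off k (λ eq → g′≢g (cong proj₁ eq))))
      at-g
      where
      at-g : point (g , h) k (g , h′) ≡ PH.point h k h′
      at-g with h′ ≟ᴴ h
      ... | yes refl = point-at (g , h) k
      ... | no h′≢h  = point-off k (λ eq → h′≢h (cong proj₂ eq))

    shift-pebble : ∀ {h h′} → Adj H h h′ → h ≢ h′ → ∀ D g → 2 ≤ D (g , h) →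
      Σ (Distribution (G □ H)) λ D′ → D ⇝ D′ ×
        (∀ x → fibre-size D x + PH.point h′ 1 x ≡ fibre-size D′ x + PH.point h 2 x)
    shift-pebble {h} {h′} adj h≢h′ D g 2≤ with remove (g , h) 2 D 2≤
    ... | D₀ , split = D₀ ⊕ point (g , h′) 1
        , ⇝-trans (discard λ z → ≤-reflexive (sym (split z)))
            (⇝-⊕ {d₁ = D₀} (discard λ _ → ≤-refl)
                 (move-point (inj₁ (refl , adj)) (λ eq → h≢h′ (cong proj₂ eq))))
        , λ x → begin
          fibre-size D x + PH.point h′ 1 x
            ≡⟨ cong (_+ PH.point h′ 1 x) (trans (sum-map-cong (λ g′ → split (g′ , x)) (vertices G)) (fibre-size-⊕ D₀ h 2 x)) ⟩
          fibre-size D₀ x + PH.point h 2 x + PH.point h′ 1 x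
            ≡⟨ lemma (fibre-size D₀ x) (PH.point h 2 x) (PH.point h′ 1 x) ⟩
          fibre-size D₀ x + PH.point h′ 1 x + PH.point h 2 x
            ≡⟨ cong (_+ PH.point h 2 x) (fibre-size-⊕ D₀ h′ 1 x) ⟨
          fibre-size (D₀ ⊕ point (g , h′) 1) x + PH.point h 2 x ∎
      where
      open ≡-Reasoning
      fibre-size-⊕ : ∀ D₀ h k x → fibre-size (D₀ ⊕ point (g , h) k) x ≡ fibre-size D₀ x + PH.point h k x
      fibre-size-⊕ D₀ h k x = trans (RG.size-⊕ (fibre D₀ x) (fibre (point (g , h) k) x))
        (cong (fibre-size D₀ x +_) (fibre-size-point g h k x))
      lemma : ∀ a b c → a + b + c ≡ a + c + b
      lemma = solve-∀

module _ {G H : Graph} where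

  size-swap : ∀ D → size (G □ H) D ≡ size (H □ G) (λ z → D (swap z))
  size-swap D = trans (size-fibres G H D)
    (sym (sum-map-cartesianProduct (λ z → D (swap z)) (vertices H) (vertices G)))

  Move-swap : ∀ {d d′} → Move (H □ G) d d′ → Move (G □ H) (λ z → d (swap z)) (λ z → d′ (swap z))
  Move-swap (x , y , adj , 2≤ , eqx , eqy , eqz) =
    swap x , swap y , adj-swap adj , 2≤ , eqx , eqy ,
    λ z z≢x z≢y → eqz (swap z) (λ eq → z≢x (cong swap eq)) (λ eq → z≢y (cong swap eq))
    where
    adj-swap : ∀ {x y} → Adj (H □ G) x y → Adj (G □ H) (swap x) (swap y)
    adj-swap (inj₁ (eq , adj)) = inj₂ (adj , eq)
    adj-swap (inj₂ (adj , eq)) = inj₁ (eq , adj)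

  -- Lets the argument assume that the inserted coordinate is the first one.
  AllSolvable-swap : ∀ {u v N} → AllSolvable (H □ G) (v , u) N → AllSolvable (G □ H) (u , v) N
  AllSolvable-swap solvable D size≡ with solvable (λ z → D (swap z)) (trans (sym (size-swap D)) size≡)
  ... | e , run , 1≤ = (λ z → e (swap z)) , gmap (λ d z → d (swap z)) Move-swap run , 1≤

-- Counting

-- The number of pebbles that reach-inserted extracts from p pebbles.
waste : ℕ → ℕ
waste n = 2 * n + 2 ^ n / 3

yield : ℕ → ℕ → ℕ
yield n p = ((p ∸ waste n) / 2 ^ n) {{m^n≢0 2 n}}

-- The least size at which the yield would be one larger. A fibre wastes the most when its size is
-- one below this.
capacity : ℕ → ℕ → ℕ
capacity n p = yield n p * 2 ^ n + (waste n + 2 ^ n)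

<-yield : ∀ n p → p + 1 ≤ capacity n p
<-yield n p = begin
  p + 1                                      ≤⟨ +-monoˡ-≤ 1 (m≤n+m∸n p (waste n)) ⟩
  waste n + x + 1                            ≡⟨ lemma₁ (waste n) x ⟩
  waste n + suc x                            ≤⟨ +-monoʳ-≤ (waste n) (begin
      suc x                                  ≡⟨ cong suc (m≡m%n+[m/n]*n x (2 ^ n)) ⟩
      suc (x % 2 ^ n) + yield n p * 2 ^ n    ≤⟨ +-monoˡ-≤ _ (m%n<n x (2 ^ n)) ⟩
      2 ^ n + yield n p * 2 ^ n              ∎) ⟩
  waste n + (2 ^ n + yield n p * 2 ^ n)      ≡⟨ lemma₂ (waste n) (2 ^ n) (yield n p * 2 ^ n) ⟩
  yield n p * 2 ^ n + (waste n + 2 ^ n)      ∎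
  where
  open ≤-Reasoning
  instance _ = m^n≢0 2 n
  x = p ∸ waste n
  lemma₁ : ∀ a b → a + b + 1 ≡ a + suc b
  lemma₁ = solve-∀
  lemma₂ : ∀ a b c → a + (b + c) ≡ c + (a + b)
  lemma₂ = solve-∀

≤-yield : ∀ n k {p} → k * 2 ^ n + waste n ≤ p → k ≤ yield n p
≤-yield n k {p} le = begin
  k                          ≡⟨ m*n/n≡m k (2 ^ n) ⟨
  k * 2 ^ n / 2 ^ n          ≤⟨ /-monoˡ-≤ (2 ^ n) (m+n≤o⇒m≤o∸n (k * 2 ^ n) le) ⟩
  (p ∸ waste n) / 2 ^ n      ∎
  where
  open ≤-Reasoning
  instance _ = m^n≢0 2 n

-- `σ` bounds from below how far each size stays from the most wasteful one. If fewer than c pebbles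
-- arrived, adding up `slack` over all fibres would contradict `budget`.
sum-yield : ∀ {I : Set} n c (xs : List I) (p σ : I → ℕ) →
  (∀ x → p x + σ x + 1 ≤ capacity n (p x)) →
  length xs * (waste n + 2 ^ n) + 2 ^ n * c + 1
    ≤ sum (map p xs) + sum (map σ xs) + length xs + 2 ^ n →
  c ≤ sum (map (λ x → yield n (p x)) xs)
sum-yield n c xs p σ slack budget with c ≤? sum (map (λ x → yield n (p x)) xs)
... | yes c≤ = c≤
... | no  c≰ = contradiction
  (≤-from 1 0 0 (+-mono-≤ budget (+-mono-≤ total (*-monoʳ-≤ (2 ^ n) (≰⇒> c≰))))
    (lemma (length xs) (waste n + 2 ^ n) (2 ^ n) c (sum (map p xs)) (sum (map σ xs)) Y)) (n≮n 0)
  where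
  Y : ℕ
  Y = sum (map (λ x → yield n (p x)) xs)
  total : sum (map p xs) + sum (map σ xs) + length xs * 1 ≤ 2 ^ n * Y + length xs * (waste n + 2 ^ n)
  total = subst₂ _≤_
    (trans (sum-map-+ (λ x → p x + σ x) (λ _ → 1) xs) (cong₂ _+_ (sum-map-+ p σ xs) (sum-map-const 1 xs)))
    (trans (sum-map-+ (λ x → 2 ^ n * yield n (p x)) (λ _ → waste n + 2 ^ n) xs)
      (cong₂ _+_ (sum-map-* (2 ^ n) (λ x → yield n (p x)) xs) (sum-map-const (waste n + 2 ^ n) xs)))
    (sum-map-mono (λ x → ≤-trans (slack x)
      (≤-reflexive (cong (_+ (waste n + 2 ^ n)) (*-comm (yield n (p x)) (2 ^ n))))) xs)
  lemma : ∀ ℓ w Q c P S Y →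
    1 + (P + S + ℓ + Q + (Q * Y + ℓ * w + Q * c)) + 0
    ≡ 0 + (ℓ * w + Q * c + 1 + (P + S + ℓ * 1 + Q * suc Y))
  lemma = solve-∀

2q≤2^n : ∀ n → 2 * (2 ^ n / 3) ≤ 2 ^ n
2q≤2^n n = ≤-trans (*-monoˡ-≤ (2 ^ n / 3) (n≤1+n 2))
  (≤-trans (≤-reflexive (*-comm 3 (2 ^ n / 3))) (m/n*n≤m (2 ^ n) 3))

3q≤2^n : ∀ n → 3 * (2 ^ n / 3) ≤ 2 ^ n
3q≤2^n n = ≤-trans (≤-reflexive (*-comm 3 (2 ^ n / 3))) (m/n*n≤m (2 ^ n) 3)

2m<2^m : ∀ m → 2 * (3 + m) < 2 ^ (3 + m)
2m<2^m zero    = n≤1+n 7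
2m<2^m (suc m) = ≤-from _ _ (5 + 2 * m) (*-monoʳ-≤ 2 (2m<2^m m)) (lemma m (2 ^ (3 + m)))
  where
  lemma : ∀ m P → suc (2 * (4 + m)) + 2 * P + (5 + 2 * m) ≡ 2 * P + 2 * suc (2 * (3 + m))
  lemma = solve-∀

-- The budget inequalities

module _ {n b} (b≥ : 2 * 2 ^ n + 2 * n ≤ b + 2) where

  private
    Q : ℕ
    Q = 2 ^ n

    b-split : 2 ≤ n → ∃[ b′ ] Q + b′ ≡ b
    b-split 2≤n = m≤n⇒∃[o]m+o≡n (≤-from Q b Q (+-mono-≤ b≥ 2≤n′) (lemma Q n b))
      where
      2≤n′ : 2 ≤ 2 * n
      2≤n′ = ≤-trans 2≤n (m≤n*m n 2)
      lemma : ∀ Q n b → Q + (b + 2 + 2 * n) + Q ≡ b + (2 * Q + 2 * n + 2)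
      lemma = solve-∀

    b′≥ : ∀ {b′} → Q + b′ ≡ b → Q + 2 * n ≤ b′ + 2
    b′≥ {b′} refl = ≤-from _ _ 0 b≥ (lemma Q n b′)
      where
      lemma : ∀ Q n b′ → Q + 2 * n + (Q + b′ + 2) + 0 ≡ b′ + 2 + (2 * Q + 2 * n)
      lemma = solve-∀

  -- Writing b = 2ⁿ + b′ cancels the price of the c pebbles. The rest, at most 6m 2ⁿ + 8mn by
  -- 2⌊2ⁿ/3⌋ ≤ 2ⁿ, is paid by b′ c, because c ≥ 6m from m = 3 on.
  budget-3≤m : ∀ {c} m → 2 ≤ n → 3 ≤ m → 2 * 2 ^ m + 2 * m ≤ c + 2 →
    4 * m * (waste n + Q) + Q * c + 1 ≤ b * c + 0 + 4 * m + Q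
  budget-3≤m {c} m 2≤n 3≤m c≥ with b-split 2≤n
  ... | b′ , eq with b′≥ eq
  ...   | le with refl ← eq = ≤-from _ _ 0
      (+-mono-≤ (*-monoʳ-≤ (6 * m) le)
      (+-mono-≤ (*-monoʳ-≤ b′ 6m≤c)
      (+-mono-≤ (*-monoʳ-≤ (2 * m) (2q≤2^n n))
      (+-mono-≤ (m^n>0 2 n) (*-monoʳ-≤ (4 * m) 2≤n)))))
      (lemma m n (2 ^ n / 3) Q c b′)
    where
    6m≤c : 6 * m ≤ c
    6m≤c with m≤n⇒∃[o]m+o≡n 3≤m
    ... | m₀ , refl = ≤-from _ _ 0 (+-mono-≤ c≥ (*-monoʳ-≤ 2 (2m<2^m m₀))) (lemma′ m₀ (2 ^ (3 + m₀)) c)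
      where
      lemma′ : ∀ m P c → 6 * (3 + m) + (c + 2 + 2 * P) + 0 ≡ c + (2 * P + 2 * (3 + m) + 2 * suc (2 * (3 + m)))
      lemma′ = solve-∀
    lemma : ∀ m n q Q c b′ →
      4 * m * (2 * n + q + Q) + Q * c + 1 + (6 * m * (b′ + 2) + (b′ * c + (2 * m * Q + (Q + 4 * m * n)))) + 0
      ≡ (Q + b′) * c + 0 + 4 * m + Q + (6 * m * (Q + 2 * n) + (b′ * (6 * m) + (2 * m * (2 * q) + (1 + 4 * m * 2))))
    lemma = solve-∀

  -- Now c may be 10 < 6m, so the sharper 3⌊2ⁿ/3⌋ ≤ 2ⁿ is used, with everything multiplied by 3.
  budget-m≡2 : ∀ {c} → 3 ≤ n → 10 ≤ c →
    8 * (waste n + Q) + Q * c + 1 ≤ b * c + 0 + 8 + Q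
  budget-m≡2 {c} 3≤n 10≤c with b-split (≤-trans (n≤1+n 2) 3≤n)
  ... | b′ , eq with b′≥ eq
  ...   | le with refl ← eq = *-cancelˡ-≤ 3 (≤-from _ _ 5
      (+-mono-≤ (*-monoʳ-≤ 30 le)
      (+-mono-≤ (*-monoʳ-≤ (3 * b′) 10≤c)
      (+-mono-≤ (*-monoʳ-≤ 8 (3q≤2^n n))
      (+-mono-≤ (^-monoʳ-≤ 2 3≤n) (*-monoʳ-≤ 12 3≤n)))))
      (lemma n (2 ^ n / 3) Q c b′))
    where
    lemma : ∀ n q Q c b′ →
      3 * (8 * (2 * n + q + Q) + Q * c + 1) + (30 * (b′ + 2) + (3 * b′ * c + (8 * Q + (Q + 12 * n)))) + 5
      ≡ 3 * ((Q + b′) * c + 0 + 8 + Q) + (30 * (Q + 2 * n) + (3 * b′ * 10 + (8 * (3 * q) + (8 + 12 * 3))))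
    lemma = solve-∀

module _ {b c} (10≤b : 10 ≤ b) (10≤c : 10 ≤ c) where

  64<bc : 64 < b * c
  64<bc = ≤-trans (m≤m+n 65 35) (*-mono-≤ 10≤b 10≤c)

  -- The extra 1 in the premise matters: for b = c = 10 the left side is 113, and 100 + 8 + 4 is
  -- only 112.
  budget-22 : ∀ {n m P S} → n ≡ 2 → m ≡ 2 → b * c + 1 ≤ P + S →
    4 * m * (waste n + 2 ^ n) + 2 ^ n * c + 1 ≤ P + S + 4 * m + 2 ^ n
  budget-22 {P = P} {S} refl refl PS = ≤-from _ (P + S + 8 + 4) 0
    (+-mono-≤ PS (+-mono-≤ (*-monoˡ-≤ c 10≤b) (*-monoʳ-≤ 6 10≤c))) (lemma b c P S)
    where
    lemma : ∀ b c P S → 72 + 4 * c + 1 + (P + S + (b * c + 6 * c)) + 0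
                      ≡ P + S + 8 + 4 + (b * c + 1 + (10 * c + 6 * 10))
    lemma = solve-∀

10≤-from-bound : ∀ {n b} → n ≡ 2 → 2 * 2 ^ n + 2 * n ≤ b + 2 → 10 ≤ b
10≤-from-bound {b = b} refl b≥ = +-cancelʳ-≤ 2 10 b b≥

-- For n = 2 the waste is 5, so the capacity is 4y + 9, and having no slack pins the size to one
-- less.
wasteful : ∀ {n x} → n ≡ 2 → ¬ (x + 1 + 1 ≤ capacity n x) → x ≡ yield 2 x * 4 + 8
wasteful {x = x} refl no-slack = ≤-antisym
  (≤-from _ _ 0 (<-yield 2 x) (lemma₁ x (yield 2 x)))
  (≤-from _ _ 0 (≰⇒> no-slack) (lemma₂ x (yield 2 x)))
  where
  lemma₁ : ∀ p y → p + (y * 4 + 9) + 0 ≡ y * 4 + 8 + (p + 1)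
  lemma₁ = solve-∀
  lemma₂ : ∀ p y → y * 4 + 8 + (p + 1 + 1) + 0 ≡ p + suc (y * 4 + 9)
  lemma₂ = solve-∀

slack-within : ∀ y q s → y * 4 + 5 ≤ q → q + s + 1 ≤ y * 4 + 9 → q + s + 1 ≤ capacity 2 q
slack-within y q s le le′ = ≤-trans le′ (+-monoˡ-≤ 9 (*-monoˡ-≤ 4 (≤-yield 2 y le)))

-- At size 4y + 6 the yield is still at least y, for which 4y + 5 suffices, and the two pebbles
-- given away turn into slack.
slack-donor : ∀ {n y x q} → n ≡ 2 → x ≡ y * 4 + 8 → x + 0 ≡ q + 2 → q + (2 + 0) + 1 ≤ capacity n q
slack-donor {y = y} {q = q} refl refl eq with refl ← +-cancelʳ-≡ 2 q (y * 4 + 6)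
  (trans (sym eq) (trans (+-identityʳ (y * 4 + 8)) (sym (+-assoc (y * 4) 6 2)))) =
  slack-within y (y * 4 + 6) 2 (+-monoʳ-≤ (y * 4) (n≤1+n 5)) (≤-reflexive (lemma y))
  where
  lemma : ∀ y → y * 4 + 6 + 2 + 1 ≡ y * 4 + 9
  lemma = solve-∀

-- The added pebble lifts the size to 4y + 9, exactly the threshold for yield y + 1; the next one is
-- 4 further on.
slack-recipient : ∀ {n y x q} → n ≡ 2 → x ≡ y * 4 + 8 → x + 1 ≡ q + 0 → q + (0 + 3) + 1 ≤ capacity n q
slack-recipient {y = y} {q = q} refl refl eq with refl ← trans (sym (+-identityʳ q)) (sym eq) =
  slack-within (suc y) (y * 4 + 8 + 1) 3 (≤-reflexive (lemma₁ y)) (≤-reflexive (lemma₂ y))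
  where
  lemma₁ : ∀ y → suc y * 4 + 5 ≡ y * 4 + 8 + 1
  lemma₁ = solve-∀
  lemma₂ : ∀ y → y * 4 + 8 + 1 + 3 + 1 ≡ suc y * 4 + 9
  lemma₂ = solve-∀

module _ (H : Graph) (_≟ᴴ_ : DecidableEquality (V H)) (n : ℕ) where

  open Reach.Points H _≟ᴴ_

  slack-point : ∀ (p : V H → ℕ) x → p x + 1 + 1 ≤ capacity n (p x) →
    ∀ y → p y + point x 1 y + 1 ≤ capacity n (p y)
  slack-point p x slack y with y ≟ᴴ x
  ... | yes refl = slack
  ... | no _     = subst (λ a → a + 1 ≤ capacity n (p y)) (sym (+-identityʳ (p y))) (<-yield n (p y))

  slack-transfer : n ≡ 2 → ∀ (p p′ : V H → ℕ) {h h′} → h ≢ h′ →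
    ¬ (p h + 1 + 1 ≤ capacity n (p h)) → ¬ (p h′ + 1 + 1 ≤ capacity n (p h′)) →
    (∀ x → p x + point h′ 1 x ≡ p′ x + point h 2 x) →
    ∀ x → p′ x + (point h 2 x + point h′ 3 x) + 1 ≤ capacity n (p′ x)
  slack-transfer n≡2 p p′ {h} {h′} h≢h′ tight tight′ moved x with x ≟ᴴ h | x ≟ᴴ h′ | moved x
  ... | yes refl | yes refl | _  = contradiction refl h≢h′
  ... | yes refl | no _     | eq = slack-donor {y = yield 2 (p h)} n≡2 (wasteful n≡2 tight) eq
  ... | no _     | yes refl | eq = slack-recipient {y = yield 2 (p h′)} n≡2 (wasteful n≡2 tight′) eq
  ... | no _     | no _     | _  =
    subst (λ a → a + 1 ≤ capacity n (p′ x)) (sym (+-identityʳ (p′ x))) (<-yield n (p′ x))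

module Counting (G H : Graph) (_≟ᴳ_ : DecidableEquality (V G)) (_≟ᴴ_ : DecidableEquality (V H))
  (n m b c : ℕ) (2≤n : 2 ≤ n) (2≤m : 2 ≤ m)
  (b≥ : 2 * 2 ^ n + 2 * n ≤ b + 2) (c≥ : 2 * 2 ^ m + 2 * m ≤ c + 2)
  (length-G : length (vertices G) ≡ 4 * n) (length-H : length (vertices H) ≡ 4 * m)
  (edge-at : ∀ x → ∃[ y ] Adj H x y × x ≢ y) (u : V G) (v : V H)
  (reach-yield : ∀ d → Reach._⇝_ G d (Reach.Points.point G _≟ᴳ_ u (yield n (size G d))))
  (solve-row : ∀ d → c ≤ size H d → Reach._⇝_ H d (Reach.Points.point H _≟ᴴ_ v 1)) where

  open Reach (G □ H)
  open Points (Product.≡-dec _≟ᴳ_ _≟ᴴ_)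
  private
    module RH = Reach H
    module PH = RH.Points _≟ᴴ_

  p : Distribution (G □ H) → V H → ℕ
  p = fibre-size G H

  solve-by-slack : ∀ D (σ : V H → ℕ) →
    (∀ h → p D h + σ h + 1 ≤ capacity n (p D h)) →
    4 * m * (waste n + 2 ^ n) + 2 ^ n * c + 1 ≤ size (G □ H) D + size H σ + 4 * m + 2 ^ n →
    D ⇝ point (u , v) 1
  solve-by-slack D σ slack budget = via-row G H _≟ᴳ_ _≟ᴴ_ (yield n) reach-yield solve-row D
    (sum-yield n c (vertices H) (p D) σ slack
      (subst₂ (λ ℓ P → ℓ * (waste n + 2 ^ n) + 2 ^ n * c + 1 ≤ P + size H σ + ℓ + 2 ^ n)
        (sym length-H) (size-fibres G H D) budget))

  solve-by-counting : ∀ D →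
    4 * m * (waste n + 2 ^ n) + 2 ^ n * c + 1 ≤ size (G □ H) D + 0 + 4 * m + 2 ^ n →
    D ⇝ point (u , v) 1
  solve-by-counting D budget = solve-by-slack D (λ _ → 0)
    (λ h → subst (λ a → a + 1 ≤ capacity n (p D h)) (sym (+-identityʳ (p D h))) (<-yield n (p D h)))
    (subst (λ a → 4 * m * (waste n + 2 ^ n) + 2 ^ n * c + 1 ≤ size (G □ H) D + a + 4 * m + 2 ^ n)
      (sym (trans (sum-map-const 0 (vertices H)) (*-zeroʳ (length (vertices H))))) budget)

  -- n = m = 2 is the one case in which counting falls one pebble short.  If two
  -- adjacent fibres waste as much as possible, moving two pebbles from one to the
  -- other costs the first nothing and gains the second a pebble.
  solve-22 : n ≡ 2 → m ≡ 2 → ∀ D → size (G □ H) D ≡ b * c → D ⇝ point (u , v) 1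
  solve-22 n≡2 m≡2 D size≡ = solved
    where
    10≤b : 10 ≤ b
    10≤b = 10≤-from-bound n≡2 b≥
    10≤c : 10 ≤ c
    10≤c = 10≤-from-bound m≡2 c≥
    solve-at : ∀ x → p D x + 1 + 1 ≤ capacity n (p D x) → D ⇝ point (u , v) 1
    solve-at x slack = solve-by-slack D (PH.point x 1) (slack-point H _≟ᴴ_ n (p D) x slack)
      (budget-22 10≤b 10≤c {n} {m} {size (G □ H) D} {size H (PH.point x 1)} n≡2 m≡2
        (≤-reflexive (sym (cong₂ _+_ size≡ (PH.size-point x 1)))))
    transfer : ∀ {h h′} → Adj H h h′ → h ≢ h′ → (g : V G) → 2 ≤ D (g , h) →
      ¬ (p D h + 1 + 1 ≤ capacity n (p D h)) → ¬ (p D h′ + 1 + 1 ≤ capacity n (p D h′)) →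
      D ⇝ point (u , v) 1
    transfer {h} {h′} adj h≢h′ g 2≤ tight tight′ with shift-pebble G H _≟ᴳ_ _≟ᴴ_ adj h≢h′ D g 2≤
    ... | D′ , D⇝D′ , fibres = ⇝-trans D⇝D′ (solve-by-slack D′ σ
        (slack-transfer H _≟ᴴ_ n n≡2 (p D) (p D′) h≢h′ tight tight′ fibres)
        (budget-22 10≤b 10≤c {n} {m} {size (G □ H) D′} {size H σ} n≡2 m≡2 size-≥))
      where
      σ : V H → ℕ
      σ x = PH.point h 2 x + PH.point h′ 3 x
      -- The move destroys one pebble, but the donor's slack of 2 more than restores it.
      size-≥ : b * c + 1 ≤ size (G □ H) D′ + size H σ
      size-≥ = begin
        b * c + 1                               ≡⟨ cong₂ _+_ size≡ (PH.size-point h′ 1) ⟨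
        size (G □ H) D + size H (PH.point h′ 1) ≡⟨ cong (_+ size H (PH.point h′ 1)) (size-fibres G H D) ⟩
        size H (p D) + size H (PH.point h′ 1)   ≡⟨ RH.size-⊕ (p D) (PH.point h′ 1) ⟨
        size H (p D RH.⊕ PH.point h′ 1)         ≡⟨ sum-map-cong fibres (vertices H) ⟩
        size H (p D′ RH.⊕ PH.point h 2)         ≡⟨ RH.size-⊕ (p D′) (PH.point h 2) ⟩
        size H (p D′) + size H (PH.point h 2)   ≡⟨ cong (_+ size H (PH.point h 2)) (size-fibres G H D′) ⟨
        size (G □ H) D′ + size H (PH.point h 2) ≤⟨ +-monoʳ-≤ (size (G □ H) D′)
          (sum-map-mono (λ x → m≤m+n (PH.point h 2 x) (PH.point h′ 3 x)) (vertices H)) ⟩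
        size (G □ H) D′ + size H σ              ∎
        where open ≤-Reasoning
    -- More than 64 pebbles on 8 fibres put more than 8 on one of them; that fibre has 8 vertices,
    -- so one carries the pair to be moved.
    crowded-fibre : ∃[ h ] 8 < p D h
    crowded-fibre = pigeonhole 8 (p D) (vertices H)
      (subst₂ (λ ℓ s → ℓ * 8 < s) (sym (trans length-H (cong (4 *_) m≡2)))
        (trans (sym size≡) (size-fibres G H D)) (64<bc 10≤b 10≤c))
    solved : D ⇝ point (u , v) 1
    solved with crowded-fibre
    ... | h , 8<ph with pigeonhole 1 (fibre G H D h) (vertices G)
                          (subst (λ ℓ → ℓ * 1 < p D h) (sym (trans length-G (cong (4 *_) n≡2))) 8<ph)
                      | edge-at h
    ...   | g , 1<Dgh | h′ , adj , h≢h′ =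
      by-slack (p D h + 1 + 1 ≤? capacity n (p D h)) (p D h′ + 1 + 1 ≤? capacity n (p D h′))
      where
      by-slack : Dec (p D h + 1 + 1 ≤ capacity n (p D h)) → Dec (p D h′ + 1 + 1 ≤ capacity n (p D h′)) →
        D ⇝ point (u , v) 1
      by-slack (yes slack) _           = solve-at h slack
      by-slack (no _)      (yes slack) = solve-at h′ slack
      by-slack (no tight)  (no tight′) = transfer adj h≢h′ g 1<Dgh tight tight′

  product-AllSolvable : AllSolvable (G □ H) (u , v) (b * c)
  product-AllSolvable D size≡ = ⇝⇒Solvable ≤-refl (solve (m≤n⇒m<n∨m≡n 2≤m) (m≤n⇒m<n∨m≡n 2≤n))
    where
    solve : 2 < m ⊎ 2 ≡ m → 2 < n ⊎ 2 ≡ n → D ⇝ point (u , v) 1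
    solve (inj₁ 3≤m) _ = solve-by-counting D
      (subst (λ s → 4 * m * (waste n + 2 ^ n) + 2 ^ n * c + 1 ≤ s + 0 + 4 * m + 2 ^ n) (sym size≡)
        (budget-3≤m {n} {b} b≥ m 2≤n 3≤m c≥))
    solve (inj₂ 2≡m) (inj₁ 3≤n) = solve-by-counting D
      (subst₂ (λ m s → 4 * m * (waste n + 2 ^ n) + 2 ^ n * c + 1 ≤ s + 0 + 4 * m + 2 ^ n) 2≡m (sym size≡)
        (budget-m≡2 {n} {b} b≥ 3≤n (10≤-from-bound (sym 2≡m) c≥)))
    solve (inj₂ 2≡m) (inj₂ 2≡n) = solve-22 (sym 2≡n) (sym 2≡m) D size≡

-- Assembling the bound for the product

module _ {k l n m} (K≡2n : suc k ≡ 2 * n) (L≡2m : suc l ≡ 2 * m) (2≤n : 2 ≤ n) (2≤m : 2 ≤ m)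
  (e : Fin (suc k)) (v : V (MiddleCycle l)) {b c}
  (b-pebbling : IsPebblingNumber (MiddleCycle k) b) (c-pebbling : IsPebblingNumber (MiddleCycle l) c) where

  private
    G H : Graph
    G = MiddleCycle k
    H = MiddleCycle l
    module RG = Reach G
    module PG = RG.Points _≟ᴹ_
    module RH = Reach H
    module PH = RH.Points _≟ᴹ_

  reach-yield : ∀ d → d RG.⇝ PG.point (inj₂ e) (yield n (size G d))
  reach-yield d with waste n ≤? size G d
  ... | yes w≤ = reach n refl
    where
    yield≤ : yield n (size G d) * 2 ^ n + waste n ≤ size G d
    yield≤ = ≤-trans (+-monoˡ-≤ (waste n) (m/n*n≤m (size G d ∸ waste n) (2 ^ n) {{m^n≢0 2 n}}))
      (≤-reflexive (m∸n+n≡m w≤))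
    reach : ∀ n₁ → n₁ ≡ n → d RG.⇝ PG.point (inj₂ e) (yield n (size G d))
    reach zero    refl = contradiction 2≤n λ ()
    reach (suc _) refl = reach-inserted K≡2n e (yield n (size G d)) d yield≤
  -- Below the waste the truncated subtraction makes the yield 0, so nothing has to be delivered.
  ... | no w≰ = RG.discard (PG.point-≼ (≡0⇒≤ (yield≡0 (m≤n⇒m∸n≡0 (<⇒≤ (≰⇒> w≰))))))
    where
    ≡0⇒≤ : ∀ {y a} → y ≡ 0 → y ≤ a
    ≡0⇒≤ refl = z≤n
    yield≡0 : size G d ∸ waste n ≡ 0 → yield n (size G d) ≡ 0
    yield≡0 eq = trans (cong (λ a → (a / 2 ^ n) {{m^n≢0 2 n}}) eq) (0/n≡0 (2 ^ n) {{m^n≢0 2 n}})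

  solve-row : ∀ d → c ≤ size H d → d RH.⇝ PH.point v 1
  solve-row d c≤ with proj₁ c-pebbling v
  ... | N , (solvable , _) , N≤c = PH.AllSolvable⇒⇝ solvable d (≤-trans N≤c c≤)

  edge-at : ∀ x → ∃[ y ] Adj H x y × x ≢ y
  edge-at (inj₁ i) = inj₂ i , inj₁ refl , λ ()
  edge-at (inj₂ f) = inj₁ f , inj₁ refl , λ ()

  middle-product-AllSolvable : AllSolvable (G □ H) (inj₂ e , v) (b * c)
  middle-product-AllSolvable = Counting.product-AllSolvable G H _≟ᴹ_ _≟ᴹ_ n m b c 2≤n 2≤m
    (LowerBound.pebbling-number-≥ K≡2n (≤-trans (s≤s z≤n) 2≤n) b-pebbling)
    (LowerBound.pebbling-number-≥ L≡2m (≤-trans (s≤s z≤n) 2≤m) c-pebbling)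
    (length-vertices n K≡2n) (length-vertices m L≡2m) edge-at (inj₂ e) v reach-yield solve-row
    where
    length-vertices : ∀ {k} n → suc k ≡ 2 * n → length (vertices (MiddleCycle k)) ≡ 4 * n
    length-vertices {k} n K≡2n = trans (length-MiddleCycle k) (trans (cong (2 *_) K≡2n) (sym (*-assoc 2 2 n)))

theorem3p2 : (n m : ℕ) → 2 ≤ n → 2 ≤ m →
    (u : V M[C2 n ]) (v : V M[C2 m ]) →
    ((∃[ e ] u ≡ inj₂ e) ⊎ (∃[ e ] v ≡ inj₂ e)) →
    (a b c : ℕ) →
    IsPebblingNumberAt (M[C2 n ] □ M[C2 m ]) (u , v) a →
    IsPebblingNumber M[C2 n ] b →
    IsPebblingNumber M[C2 m ] c →
    a ≤ b * c
theorem3p2 n m 2≤n 2≤m u v inserted a b c (_ , minimal) b-pebbling c-pebbling =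
  ≮⇒≥ (λ bc<a → minimal (b * c) bc<a (solvable inserted))
  where
  length≡ : ∀ {n} → 2 ≤ n → suc (2 * n ∸ 1) ≡ 2 * n
  length≡ {n} 2≤n = m+[n∸m]≡n (≤-trans (≤-trans (s≤s z≤n) 2≤n) (m≤n*m n 2))
  solvable : (∃[ e ] u ≡ inj₂ e) ⊎ (∃[ e ] v ≡ inj₂ e) →
    AllSolvable (M[C2 n ] □ M[C2 m ]) (u , v) (b * c)
  solvable (inj₁ (e , refl)) =
    middle-product-AllSolvable (length≡ 2≤n) (length≡ 2≤m) 2≤n 2≤m e v b-pebbling c-pebbling
  solvable (inj₂ (e , refl)) = AllSolvable-swap {M[C2 n ]} {M[C2 m ]}
    (subst (AllSolvable (M[C2 m ] □ M[C2 n ]) (inj₂ e , u)) (*-comm c b)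
      (middle-product-AllSolvable (length≡ 2≤m) (length≡ 2≤n) 2≤m 2≤n e u c-pebbling b-pebbling))
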